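{- A subset $\mathcal{P}$ of $\mathbb{R}_{\max}^n$ is a tropical polyhedron with mixed constraints if, and only if, $\mathcal{P}$ is tropically convex and is a union of finitely many zones of $\mathbb{R}_{\max}^n$.
   Context: $\mathbb{R}_{\max}=\mathbb{R}\cup\{ -\infty\}$ is the max-plus semiring ($x\oplus y=\max(x,y)$, $x\otimes y=xy=x+y$), and $\overline{\mathbb{R}}_{\max}=\mathbb{R}_{\max}\cup\{+\infty\}$. Let $\mathbb{R}^-=\{\alpha^-:\alpha\in\mathbb{R}\}$ be a disjoint copy of $\mathbb{R}$ and $\mathbb{G}=\overline{\mathbb{R}}_{\max}\cup\mathbb{R}^-$. The modulus is $|x|=x$ for $x\in\overline{\mathbb{R}}_{\max}$ and $|\alpha^-|=\alpha$. The total order $\leq_{\mathbb{G}}$ is: $x\leq_{\mathbb{G}}y$ iff $|x|<|y|$ when $x\in\overline{\mathbb{R}}_{\max}$ and $y\in\mathbb{R}^-$, and $|x|\le|y|$ in all other cases. $\mathbb{G}$ is a semiring where $x\oplus y$ is the greater of $x,y$ for $\leq_{\mathbb{G}}$, and $xy$ is: $x+y$ if $x,y\in\mathbb{R}$; $(|x|+|y|)^-$ if $x\in\mathbb{R}^-$ or $y\in\mathbb{R}^-$ and both are different from $\pm\infty$; $-\infty$ if $x=-\infty$ or $y=-\infty$; $+\infty$ if neither is $-\infty$ and at least one is $+\infty$. A mixed tropical affine inequality is a constraint $a_0\oplus a_1\mathbf{x}_1\oplus\cdots\oplus a_n\mathbf{x}_n\leq_{\mathbb{G}}b_0\oplus b_1\mathbf{x}_1\oplus\cdots\oplus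 b_n\mathbf{x}_n$ with $a_i\in\mathbb{R}_{\max}$ and $b_i\in\mathbb{G}$. A tropical polyhedron with mixed constraints is the set of $\mathbf{x}\in\mathbb{R}_{\max}^n$ satisfying finitely many mixed tropical affine inequalities. A subset $\mathcal{C}\subset\mathbb{R}_{\max}^n$ is tropically convex if $\lambda\mathbf{x}\oplus\mu\mathbf{y}\in\mathcal{C}$ for all $\mathbf{x},\mathbf{y}\in\mathcal{C}$ and $\lambda,\mu\in\mathbb{R}_{\max}$ with $\lambda\oplus\mu=0$. A zone of $\mathbb{R}_{\max}^n$ is a set of vectors $\mathbf{x}\in\mathbb{R}_{\max}^n$ defined by finitely many inequalities of the forms $m_i\lhd\mathbf{x}_i$, $\mathbf{x}_i\lhd M_i$, $\mathbf{x}_i\lhd k_{ij}\mathbf{x}_j$ (i.e. $k_{ij}+\mathbf{x}_j$), where each $\lhd$ is $\leq$ or $<$ and $m_i,M_i,k_{ij}\in\mathbb{R}_{\max}$. -}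

module Defs where

open import Level using (Level; 0ℓ; suc; _⊔_)
open import Algebra.Structures using (IsCommutativeRing)
open import Data.Fin.Base using (Fin)
open import Data.List.Base using (List)
open import Data.List.Relation.Unary.All using (All)
open import Data.List.Relation.Unary.Any using (Any)
open import Data.Nat.Base using (ℕ)
open import Data.Product.Base using (∃; ∃-syntax; _×_; _,_)
open import Data.Sum.Base using (inj₁; inj₂)
open import Data.Vec.Base using (Vec; foldr′; lookup; map; zipWith)
open import Relation.Binary.Bundles using (StrictTotalOrder; TotalOrder)
open import Relation.Binary.Core using (Rel)
open import Relation.Binary.Definitions using (Antisymmetric; Total; Transitive; tri<; tri≈; tri>)
open import Relation.Binary.Structures using (IsStrictTotalOrder)
open import Relation.Binary.PropositionalEquality using (_≡_; _≢_; refl; cong; isEquivalence)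
open import Relation.Nullary.Construct.Add.Extrema using (_±; ⊥±; [_]; ⊤±)
open import Relation.Nullary.Construct.Add.Infimum as Inf using (_₋; ⊥₋)
open import Relation.Nullary.Construct.Add.Supremum as Sup using ()
open import Relation.Nullary.Negation using (contradiction)
open import Relation.Unary using (Pred; _∈_; _≐_; Satisfiable)
import Algebra.Construct.NaturalChoice.Max as Max
import Relation.Binary.Construct.Add.Extrema.Strict as AddExtrema
import Relation.Binary.Construct.Add.Infimum.Strict as AddInfimum
import Relation.Binary.Construct.StrictToNonStrict as ToNonStrict
import Relation.Binary.Properties.StrictTotalOrder as StrictTotalOrderProperties

-- The real numbers, given axiomatically as a Dedekind-complete ordered field.
-- Classically these axioms determine ℝ up to unique isomorphism; trichotomy is
-- part of them (`compare` in `isStrictTotalOrder`).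

record Reals : Set₁ where
  infix  8 -_
  infixl 7 _*_
  infixl 6 _+_
  infix  4 _<_
  field
    ℝ   : Set
    _<_ : Rel ℝ 0ℓ
    _+_ : ℝ → ℝ → ℝ
    _*_ : ℝ → ℝ → ℝ
    -_  : ℝ → ℝ
    0#  : ℝ
    1#  : ℝ
    isCommutativeRing  : IsCommutativeRing _≡_ _+_ _*_ -_ 0# 1#
    0≢1                : 0# ≢ 1#
    inverse            : ∀ x → x ≢ 0# → ∃[ y ] x * y ≡ 1#
    isStrictTotalOrder : IsStrictTotalOrder _≡_ _<_
    +-monoʳ-<          : ∀ x {y z} → y < z → x + y < x + z
    *-pos              : ∀ {x y} → 0# < x → 0# < y → 0# < x * y

  open ToNonStrict _≡_ _<_ public using (_≤_)

  UpperBound : Pred ℝ 0ℓ → Pred ℝ 0ℓ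
  UpperBound S b = ∀ {x} → x ∈ S → x ≤ b

  field
    complete : (S : Pred ℝ 0ℓ) → Satisfiable S → Satisfiable (UpperBound S) →
               ∃[ s ] UpperBound S s × (∀ {b} → UpperBound S b → s ≤ b)

module Tropical (R : Reals) where

  open Reals R using (ℝ; 0#; _+_)

  Rmax : Set
  Rmax = ℝ ₋

  Rmax-strictTotalOrder : StrictTotalOrder 0ℓ 0ℓ 0ℓ
  Rmax-strictTotalOrder = record
    { isStrictTotalOrder =
        AddInfimum.<₋-isStrictTotalOrder-≡ (Reals._<_ R) (Reals.isStrictTotalOrder R) }

  open StrictTotalOrder Rmax-strictTotalOrder public using (_<_)
  open StrictTotalOrderProperties Rmax-strictTotalOrder public
    using (_≤_) renaming (totalOrder to Rmax-totalOrder)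

  open Max Rmax-totalOrder public using () renaming (_⊔_ to _⊕_)

  infixl 7 _⊗_
  _⊗_ : Rmax → Rmax → Rmax
  ⊥₋        ⊗ _         = ⊥₋
  Inf.[ _ ] ⊗ ⊥₋        = ⊥₋
  Inf.[ x ] ⊗ Inf.[ y ] = Inf.[ x + y ]

  -- definitionally Rmax ⁺
  R̄max : Set
  R̄max = ℝ ±

  R̄max-strictTotalOrder : StrictTotalOrder 0ℓ 0ℓ 0ℓ
  R̄max-strictTotalOrder = record
    { isStrictTotalOrder =
        AddExtrema.<±-isStrictTotalOrder-≡ (Reals._<_ R) (Reals.isStrictTotalOrder R) }

  private
    module R̄< = StrictTotalOrder R̄max-strictTotalOrder
    module R̄≤ = StrictTotalOrderProperties R̄max-strictTotalOrder
    module R̄  = ToNonStrict _≡_ R̄<._<_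

  open R̄< public using () renaming (_<_ to _<̄_)
  open R̄≤ public using () renaming (_≤_ to _≤̄_)

  infix 9 _⁻
  data 𝔾 : Set where
    ι  : R̄max → 𝔾
    _⁻ : ℝ → 𝔾

  pattern -∞     = ι ⊥±
  pattern +∞     = ι ⊤±
  pattern real x = ι [ x ]

  ∣_∣ : 𝔾 → R̄max
  ∣ ι x ∣ = x
  ∣ α ⁻ ∣ = [ α ]

  infix 4 _≤ᴳ_
  _≤ᴳ_ : Rel 𝔾 0ℓ
  ι x ≤ᴳ α ⁻ = ∣ ι x ∣ <̄ ∣ α ⁻ ∣
  x   ≤ᴳ y   = ∣ x ∣ ≤̄ ∣ y ∣

  private
    <-≤-trans : ∀ {x y z} → x <̄ y → y ≤̄ z → x <̄ z
    <-≤-trans {x} = R̄.<-≤-trans R̄<.trans R̄<.<-respʳ-≈ {x}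

    ≤-<-trans : ∀ {x y z} → x ≤̄ y → y <̄ z → x <̄ z
    ≤-<-trans {x} = R̄.≤-<-trans R̄<.Eq.sym R̄<.trans R̄<.<-respˡ-≈ {x}

  ≤ᴳ-reflexive : ∀ {x y} → x ≡ y → x ≤ᴳ y
  ≤ᴳ-reflexive {ι _} refl = inj₂ refl
  ≤ᴳ-reflexive {_ ⁻} refl = inj₂ refl

  ≤ᴳ-trans : Transitive _≤ᴳ_
  ≤ᴳ-trans {ι _} {ι _} {ι _} p q = R̄≤.trans p q
  ≤ᴳ-trans {ι _} {ι _} {_ ⁻} p q = ≤-<-trans p q
  ≤ᴳ-trans {ι _} {_ ⁻} {ι _} p q = R̄≤.trans (inj₁ p) q
  ≤ᴳ-trans {ι _} {_ ⁻} {_ ⁻} p q = <-≤-trans p q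
  ≤ᴳ-trans {_ ⁻} {ι _} {ι _} p q = R̄≤.trans p q
  ≤ᴳ-trans {_ ⁻} {ι _} {_ ⁻} p q = inj₁ (≤-<-trans p q)
  ≤ᴳ-trans {_ ⁻} {_ ⁻} {ι _} p q = R̄≤.trans p q
  ≤ᴳ-trans {_ ⁻} {_ ⁻} {_ ⁻} p q = R̄≤.trans p q

  ≤ᴳ-antisym : Antisymmetric _≡_ _≤ᴳ_
  ≤ᴳ-antisym {ι _} {ι _} p q = cong ι (R̄≤.antisym p q)
  ≤ᴳ-antisym {ι _} {_ ⁻} p q = contradiction (<-≤-trans p q) (R̄<.irrefl refl)
  ≤ᴳ-antisym {_ ⁻} {ι _} p q = contradiction (<-≤-trans q p) (R̄<.irrefl refl)
  ≤ᴳ-antisym {_ ⁻} {_ ⁻} p q with refl ← R̄≤.antisym p q = refl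

  ≤ᴳ-total : Total _≤ᴳ_
  ≤ᴳ-total (ι x) (ι y) = R̄≤.total x y
  ≤ᴳ-total (ι x) (β ⁻) with R̄<.compare x [ β ]
  ... | tri< p _ _ = inj₁ p
  ... | tri≈ _ refl _ = inj₂ (inj₂ refl)
  ... | tri> _ _ p = inj₂ (inj₁ p)
  ≤ᴳ-total (α ⁻) (ι y) with R̄<.compare [ α ] y
  ... | tri< p _ _ = inj₁ (inj₁ p)
  ... | tri≈ _ refl _ = inj₁ (inj₂ refl)
  ... | tri> _ _ p = inj₂ p
  ≤ᴳ-total (α ⁻) (β ⁻) = R̄≤.total [ α ] [ β ]

  𝔾-totalOrder : TotalOrder 0ℓ 0ℓ 0ℓ
  𝔾-totalOrder = record
    { isTotalOrder = record
      { isPartialOrder = record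
        { isPreorder = record
          { isEquivalence = isEquivalence
          ; reflexive     = ≤ᴳ-reflexive
          ; trans         = λ {x} {y} {z} → ≤ᴳ-trans {x} {y} {z}
          }
        ; antisym = ≤ᴳ-antisym
        }
      ; total = ≤ᴳ-total
      }
    }

  open Max 𝔾-totalOrder public using () renaming (_⊔_ to _⊕ᴳ_)

  infixl 7 _⊗ᴳ_
  _⊗ᴳ_ : 𝔾 → 𝔾 → 𝔾
  -∞     ⊗ᴳ _      = -∞
  _      ⊗ᴳ -∞     = -∞
  +∞     ⊗ᴳ _      = +∞
  _      ⊗ᴳ +∞     = +∞
  real x ⊗ᴳ real y = real (x + y)
  real x ⊗ᴳ β ⁻    = (x + β) ⁻
  α ⁻    ⊗ᴳ real y = (α + y) ⁻
  α ⁻    ⊗ᴳ β ⁻    = (α + β) ⁻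

  embed : Rmax → 𝔾
  embed x = ι Sup.[ x ]

  private variable
    n : ℕ
    ℓ : Level

  Point : ℕ → Set
  Point = Vec Rmax

  -- b₀ ⊕ b₁𝐱₁ ⊕ ⋯ ⊕ bₙ𝐱ₙ; the empty sum is -∞, the zero of 𝔾.
  affine : 𝔾 → Vec 𝔾 n → Point n → 𝔾
  affine b₀ b x = b₀ ⊕ᴳ foldr′ _⊕ᴳ_ -∞ (zipWith _⊗ᴳ_ b (map embed x))

  record MixedInequality (n : ℕ) : Set where
    field
      a₀ : Rmax
      a  : Vec Rmax n
      b₀ : 𝔾
      b  : Vec 𝔾 n

  Satisfies : Point n → Pred (MixedInequality n) 0ℓ
  Satisfies x I = affine (embed a₀) (map embed a) x ≤ᴳ affine b₀ b x
    where open MixedInequality I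

  IsMixedPolyhedron : Pred (Point n) ℓ → Set ℓ
  IsMixedPolyhedron P =
    ∃ λ (Is : List (MixedInequality _)) → P ≐ (λ x → All (Satisfies x) Is)

  IsTropicallyConvex : Pred (Point n) ℓ → Set ℓ
  IsTropicallyConvex C =
    ∀ {x y} (λ′ μ : Rmax) → x ∈ C → y ∈ C → λ′ ⊕ μ ≡ Inf.[ 0# ] →
    zipWith _⊕_ (map (λ′ ⊗_) x) (map (μ ⊗_) y) ∈ C

  data Comparison : Set where
    nonstrict strict : Comparison

  infix 4 _⊲[_]_
  _⊲[_]_ : Rmax → Comparison → Rmax → Set
  x ⊲[ nonstrict ] y = x ≤ y
  x ⊲[ strict    ] y = x < y

  data ZoneInequality (n : ℕ) : Set where
    lower      : Comparison → (m : Rmax) (i : Fin n) → ZoneInequality n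
    upper      : Comparison → (i : Fin n) (M : Rmax) → ZoneInequality n
    difference : Comparison → (i : Fin n) (k : Rmax) (j : Fin n) → ZoneInequality n

  SatisfiesZone : Point n → Pred (ZoneInequality n) 0ℓ
  SatisfiesZone x (lower c m i)        = m ⊲[ c ] lookup x i
  SatisfiesZone x (upper c i M)        = lookup x i ⊲[ c ] M
  SatisfiesZone x (difference c i k j) = lookup x i ⊲[ c ] (k ⊗ lookup x j)

  IsZone : Pred (Point n) ℓ → Set ℓ
  IsZone Z = ∃ λ (Is : List (ZoneInequality _)) → Z ≐ (λ x → All (SatisfiesZone x) Is)

  IsFiniteUnionOfZones : Pred (Point n) ℓ → Set (suc 0ℓ ⊔ ℓ)
  IsFiniteUnionOfZones {n} P =
    ∃ λ (Zs : List (Pred (Point n) 0ℓ)) → All IsZone Zs × P ≐ (λ x → Any (x ∈_) Zs)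

{-# OPTIONS --safe #-}
module Submission where

-- Work in homogeneous coordinates, with 𝐱 replaced by (0 , 𝐱), where every mixed inequality is a
-- conjunction of inequalities 𝐱ᵢ ≤ ⨁ⱼ bⱼ 𝐱ⱼ over 𝔾.
--
-- A solution set of mixed inequalities is convex because both sides are 𝔾-linear, and it is a finite
-- union of zones because a ⨁ on the right is one of its terms and each 𝐱ᵢ ≤ b 𝐱ⱼ is a union of zones.
--
-- Conversely, the coefficient 0⁻ expresses strict inequalities and the coefficient +∞ expresses
-- implications 𝐱₀ = -∞ ⇒ 𝐱ᵢ = -∞, so the cone { λ (0 , 𝐱) ∣ 𝐱 ∈ Z } over a zone Z, together with -∞,
-- is defined by homogeneous inequalities. Systems of such inequalities are closed under projection
-- (Fourier–Motzkin elimination, where a bound in 𝔾 on the eliminated variable is as good as a value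
-- in Rmax), hence under sums z ⊕ w. If P is convex and is the union of the zones Zₖ, the sum of the
-- cones over the Zₖ is the cone over P, and setting 𝐱₀ = 0 gives mixed inequalities for P.

open import Defs
open import Algebra.Bundles using (AbelianGroup)
open import Algebra.Structures using (IsCommutativeRing)
import Algebra.Construct.NaturalChoice.Max as Max
import Algebra.Properties.AbelianGroup as AbelianGroupProperties
import Algebra.Properties.CommutativeSemigroup as CommutativeSemigroupProperties
open import Data.Fin.Base using (Fin; zero; suc; _↑ˡ_; _↑ʳ_)
open import Data.List.Base as List using (List; []; _∷_)
import Data.List.Extrema as Extrema
open import Data.List.Relation.Unary.All as All using (All; []; _∷_)
import Data.List.Relation.Unary.All.Properties as All
open import Data.List.Relation.Unary.Any as Any using (Any; here; there)
import Data.List.Relation.Unary.Any.Properties as Any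
open import Data.Nat.Base using (ℕ; zero; suc)
import Data.Nat.Base as ℕ
open import Data.Product.Base using (_×_; ∃; ∃-syntax; _,_; proj₁; proj₂)
open import Data.Sum.Base as Sum using (_⊎_; inj₁; inj₂)
open import Data.Vec.Base
  using (Vec; []; _∷_; _++_; foldr′; head; lookup; map; replicate; tail; zipWith; _[_]≔_)
open import Data.Vec.Properties
  using (∷-injectiveˡ; ∷-injectiveʳ; lookup-++ˡ; lookup-++ʳ; lookup-map; lookup-replicate;
         lookup-zipWith; map-++; map-∘; map-[]≔; map-cong; map-id; map-replicate; tabulate∘lookup;
         tabulate-cong; zipWith-comm; zipWith-identityˡ; zipWith-identityʳ)
open import Function.Base using (_∘_; id)
open import Function.Bundles using (_⇔_; mk⇔; module Equivalence)
open import Level using (Level; 0ℓ)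
open import Relation.Binary.Bundles using (StrictTotalOrder; TotalOrder)
open import Relation.Binary.Definitions using (tri<; tri≈; tri>)
open import Relation.Binary.PropositionalEquality hiding ([_])
open import Relation.Binary.Structures using (IsStrictTotalOrder)
open import Relation.Nullary.Construct.Add.Extrema using ([_])
open import Relation.Nullary.Construct.Add.Infimum as Inf using (⊥₋)
import Relation.Binary.Construct.Add.Extrema.Strict as AddExtrema
import Relation.Binary.Construct.Add.Infimum.Strict as AddInfimum
import Relation.Binary.Construct.Add.Supremum.Strict as AddSupremum
import Relation.Binary.Properties.StrictTotalOrder as StrictTotalOrderProperties
open import Relation.Nullary.Decidable.Core using (Dec; yes; no)
open import Relation.Nullary.Negation using (¬_; contradiction)
open import Relation.Unary using (Pred; _∈_; _∪_; _∩_)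

-- The reals as an ordered group: unboundedness, halving and density.

module RealProperties (R : Reals) where
  open Reals R
  open IsCommutativeRing isCommutativeRing public
    using (+-assoc; +-comm; +-identityˡ; +-identityʳ; -‿inverseˡ; -‿inverseʳ;
           distribˡ; distribʳ; *-identityˡ; *-identityʳ; +-isAbelianGroup)
  open IsStrictTotalOrder isStrictTotalOrder public
    using (compare) renaming (trans to <-trans; irrefl to <-irrefl)

  private
    +-abelianGroup : AbelianGroup _ _
    +-abelianGroup = record { isAbelianGroup = +-isAbelianGroup }

  open AbelianGroupProperties +-abelianGroup public using () renaming (xyx⁻¹≈y to x+y-x≡y)

  +-monoˡ-< : ∀ x {y z} → y < z → y + x < z + x
  +-monoˡ-< x {y} {z} y<z = subst₂ _<_ (+-comm x y) (+-comm x z) (+-monoʳ-< x y<z)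

  +-monoʳ-≤ : ∀ x {y z} → y ≤ z → x + y ≤ x + z
  +-monoʳ-≤ x (inj₁ y<z)  = inj₁ (+-monoʳ-< x y<z)
  +-monoʳ-≤ x (inj₂ refl) = inj₂ refl

  +-monoˡ-≤ : ∀ x {y z} → y ≤ z → y + x ≤ z + x
  +-monoˡ-≤ x (inj₁ y<z)  = inj₁ (+-monoˡ-< x y<z)
  +-monoˡ-≤ x (inj₂ refl) = inj₂ refl

  x+[y-x]≡y : ∀ x y → x + (y + - x) ≡ y
  x+[y-x]≡y x y = trans (sym (+-assoc x y (- x))) (x+y-x≡y x y)

  -x+[x+y]≡y : ∀ x y → - x + (x + y) ≡ y
  -x+[x+y]≡y x y = trans (sym (+-assoc (- x) x y)) (trans (cong (_+ y) (-‿inverseˡ x)) (+-identityˡ y))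

  x+[-x+y]≡y : ∀ x y → x + (- x + y) ≡ y
  x+[-x+y]≡y x y = trans (sym (+-assoc x (- x) y)) (trans (cong (_+ y) (-‿inverseʳ x)) (+-identityˡ y))

  <⇒≱ : ∀ {x y} → x < y → ¬ y ≤ x
  <⇒≱ x<y (inj₁ y<x) = <-irrefl refl (<-trans x<y y<x)
  <⇒≱ x<y (inj₂ y≡x) = <-irrefl (sym y≡x) x<y

  -- Whichever of 1 and -1 is positive serves, so the sign of 1 need not be decided.
  positive : ∃[ ε ] 0# < ε
  positive with compare 0# 1#
  ... | tri< 0<1 _ _ = 1# , 0<1
  ... | tri≈ _ 0≡1 _ = contradiction 0≡1 0≢1
  ... | tri> _ _ 1<0 = - 1# , subst₂ _<_ (-‿inverseˡ 1#) (+-identityʳ (- 1#)) (+-monoʳ-< (- 1#) 1<0)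

  unboundedAbove : ∀ x → ∃[ y ] x < y
  unboundedAbove x =
    let ε , 0<ε = positive in x + ε , subst (_< x + ε) (+-identityʳ x) (+-monoʳ-< x 0<ε)

  unboundedBelow : ∀ x → ∃[ y ] y < x
  unboundedBelow x =
    let ε , 0<ε = positive in
    x + - ε , subst₂ _<_ (+-identityʳ (x + - ε))
                (trans (+-assoc x (- ε) ε) (trans (cong (x +_) (-‿inverseˡ ε)) (+-identityʳ x)))
                (+-monoʳ-< (x + - ε) 0<ε)

  -- Either sign of 1 passes on to 1 + 1, again without deciding which sign it is.
  1+1≢0 : 1# + 1# ≢ 0#
  1+1≢0 eq with compare 0# 1#
  ... | tri< 0<1 _ _ =
    <-irrefl (sym eq) (<-trans 0<1 (subst (_< 1# + 1#) (+-identityʳ 1#) (+-monoʳ-< 1# 0<1)))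
  ... | tri≈ _ 0≡1 _ = 0≢1 0≡1
  ... | tri> _ _ 1<0 =
    <-irrefl eq (<-trans (subst (1# + 1# <_) (+-identityʳ 1#) (+-monoʳ-< 1# 1<0)) 1<0)

  halve : ∀ x → ∃[ y ] y + y ≡ x
  halve x =
    let h , 2h≡1 = inverse (1# + 1#) 1+1≢0 in
    x * h , (begin
      x * h + x * h            ≡⟨ distribˡ x h h ⟨
      x * (h + h)              ≡⟨ cong (x *_) (cong₂ _+_ (*-identityˡ h) (*-identityˡ h)) ⟨
      x * (1# * h + 1# * h)    ≡⟨ cong (x *_) (distribʳ h 1# 1#) ⟨
      x * ((1# + 1#) * h)      ≡⟨ cong (x *_) 2h≡1 ⟩
      x * 1#                   ≡⟨ *-identityʳ x ⟩
      x                        ∎)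
    where open ≡-Reasoning

  +-mono-< : ∀ {x y z w} → x < y → z < w → x + z < y + w
  +-mono-< {y = y} {z} x<y z<w = <-trans (+-monoˡ-< z x<y) (+-monoʳ-< y z<w)

  -- The midpoint lies strictly between: m ≤ x would give m + m ≤ x + x < x + y, and y ≤ m would
  -- give x + y < y + y ≤ m + m.
  dense : ∀ {x y} → x < y → ∃[ m ] x < m × m < y
  dense {x} {y} x<y with m , m+m≡x+y ← halve (x + y) = m , x<m , m<y
    where
    x<m : x < m
    x<m with compare x m
    ... | tri< p _ _ = p
    ... | tri≈ _ refl _ = contradiction (+-monoʳ-< x x<y) (<-irrefl m+m≡x+y)
    ... | tri> _ _ m<x = contradiction (<-trans (+-mono-< m<x m<x) (+-monoʳ-< x x<y)) (<-irrefl m+m≡x+y)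
    m<y : m < y
    m<y with compare m y
    ... | tri< p _ _ = p
    ... | tri≈ _ refl _ = contradiction (+-monoˡ-< y x<y) (<-irrefl (sym m+m≡x+y))
    ... | tri> _ _ y<m = contradiction (<-trans (+-monoˡ-< y x<y) (+-mono-< y<m y<m)) (<-irrefl (sym m+m≡x+y))

module MaxPlus (R : Reals) where
  open Tropical R
  open Reals R using (ℝ; 0#; -_; _+_; +-monoʳ-<) renaming (_<_ to _<ℝ_; _≤_ to _≤ℝ_)
  open RealProperties R

  private
    module R̄ = AddExtrema _<ℝ_
    module Maxᴳ = Max 𝔾-totalOrder
    module Maxᴿ = Max Rmax-totalOrder

  open Extrema 𝔾-totalOrder using (argmin; argmin-all; f[argmin]≤f[xs])
  open Maxᴳ public using ()
    renaming (⊔-sel to ⊕-sel; ⊔-assoc to ⊕-assoc; ⊔-comm to ⊕-comm)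
  open CommutativeSemigroupProperties Maxᴳ.⊔-commutativeSemigroup public
    using () renaming (interchange to ⊕-interchange)

  -- `_≤ᴳ_` computes on its arguments, so they could not be inferred from it.
  infix 4 _⊑_
  record _⊑_ (x y : 𝔾) : Set where
    constructor ⊑⁺
    field ⊑⁻ : x ≤ᴳ y
  open _⊑_ public

  -- The order of 𝔾 and its maxima.

  ⊑-refl : ∀ {x} → x ⊑ x
  ⊑-refl {x} = ⊑⁺ (≤ᴳ-reflexive {x} refl)

  ⊑-reflexive : ∀ {x y} → x ≡ y → x ⊑ y
  ⊑-reflexive refl = ⊑-refl

  ⊑-trans : ∀ {x y z} → x ⊑ y → y ⊑ z → x ⊑ z
  ⊑-trans {x} {y} {z} (⊑⁺ p) (⊑⁺ q) = ⊑⁺ (≤ᴳ-trans {x} {y} {z} p q)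

  ⊑-antisym : ∀ {x y} → x ⊑ y → y ⊑ x → x ≡ y
  ⊑-antisym (⊑⁺ p) (⊑⁺ q) = ≤ᴳ-antisym p q

  x⊑x⊕y : ∀ x y → x ⊑ x ⊕ᴳ y
  x⊑x⊕y x y = ⊑⁺ (Maxᴳ.x≤x⊔y x y)

  y⊑x⊕y : ∀ x y → y ⊑ x ⊕ᴳ y
  y⊑x⊕y x y = ⊑⁺ (Maxᴳ.x≤y⊔x x y)

  ⊕-lub : ∀ {x y z} → x ⊑ z → y ⊑ z → x ⊕ᴳ y ⊑ z
  ⊕-lub {x} {y} {z} (⊑⁺ p) (⊑⁺ q) = ⊑⁺ (Maxᴳ.⊔-lub {z} {x} {y} p q)

  x⊑y⇒x⊕y≡y : ∀ {x y} → x ⊑ y → x ⊕ᴳ y ≡ y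
  x⊑y⇒x⊕y≡y {x} {y} (⊑⁺ p) = Maxᴳ.x≤y⇒x⊔y≈y {y} {x} p

  ⊕-mono : ∀ {x y z w} → x ⊑ y → z ⊑ w → x ⊕ᴳ z ⊑ y ⊕ᴳ w
  ⊕-mono {y = y} {w = w} p q = ⊕-lub (⊑-trans p (x⊑x⊕y y w)) (⊑-trans q (y⊑x⊕y y w))

  -- In a total order a maximum is one of its two arguments. This is the source of every case
  -- distinction on a sum on the right of an inequality.
  ⊑-split : ∀ {x} y z → x ⊑ y ⊕ᴳ z → x ⊑ y ⊎ x ⊑ z
  ⊑-split {x} y z p with ⊕-sel y z
  ... | inj₁ eq = inj₁ (subst (x ⊑_) eq p)
  ... | inj₂ eq = inj₂ (subst (x ⊑_) eq p)

  ⊥-least : ∀ {x} → -∞ ⊑ x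
  ⊥-least { -∞ }   = ⊑-refl
  ⊥-least {real _} = ⊑⁺ (inj₁ R̄.⊥±<[ _ ])
  ⊥-least {+∞}     = ⊑⁺ (inj₁ R̄.⊥±<⊤±)
  ⊥-least {_ ⁻}    = ⊑⁺ R̄.⊥±<[ _ ]

  ⊤-greatest : ∀ {x} → x ⊑ +∞
  ⊤-greatest { -∞ }   = ⊥-least
  ⊤-greatest {real _} = ⊑⁺ (inj₁ R̄.[ _ ]<⊤±)
  ⊤-greatest {+∞}     = ⊑-refl
  ⊤-greatest {_ ⁻}    = ⊑⁺ (inj₁ R̄.[ _ ]<⊤±)

  ⊕-identityˡ : ∀ x → -∞ ⊕ᴳ x ≡ x
  ⊕-identityˡ = Maxᴳ.⊔-identityˡ (λ x → ⊑⁻ (⊥-least {x}))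

  ⊕-identityʳ : ∀ x → x ⊕ᴳ -∞ ≡ x
  ⊕-identityʳ = Maxᴳ.⊔-identityʳ (λ x → ⊑⁻ (⊥-least {x}))

  ≤̄⁺ : ∀ {x y} → x ≤ℝ y → [ x ] ≤̄ [ y ]
  ≤̄⁺ (inj₁ p)    = inj₁ R̄.[ p ]
  ≤̄⁺ (inj₂ refl) = inj₂ refl

  ≤̄⁻ : ∀ {x y} → [ x ] ≤̄ [ y ] → x ≤ℝ y
  ≤̄⁻ (inj₁ R̄.[ p ]) = inj₁ p
  ≤̄⁻ (inj₂ refl)    = inj₂ refl

  -- The semiring laws of 𝔾.

  ⊗-zeroʳ : ∀ x → x ⊗ᴳ -∞ ≡ -∞
  ⊗-zeroʳ -∞       = refl
  ⊗-zeroʳ (real _) = refl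
  ⊗-zeroʳ +∞       = refl
  ⊗-zeroʳ (_ ⁻)    = refl

  ⊗-identityˡ : ∀ x → real 0# ⊗ᴳ x ≡ x
  ⊗-identityˡ -∞       = refl
  ⊗-identityˡ (real x) = cong real (+-identityˡ x)
  ⊗-identityˡ +∞       = refl
  ⊗-identityˡ (x ⁻)    = cong _⁻ (+-identityˡ x)

  ⊗-comm : ∀ x y → x ⊗ᴳ y ≡ y ⊗ᴳ x
  ⊗-comm -∞       y        = sym (⊗-zeroʳ y)
  ⊗-comm (real x) -∞       = refl
  ⊗-comm (real x) (real y) = cong real (+-comm x y)
  ⊗-comm (real x) +∞       = refl
  ⊗-comm (real x) (y ⁻)    = cong _⁻ (+-comm x y)
  ⊗-comm +∞       -∞       = refl
  ⊗-comm +∞       (real y) = refl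
  ⊗-comm +∞       +∞       = refl
  ⊗-comm +∞       (y ⁻)    = refl
  ⊗-comm (x ⁻)    -∞       = refl
  ⊗-comm (x ⁻)    (real y) = cong _⁻ (+-comm x y)
  ⊗-comm (x ⁻)    +∞       = refl
  ⊗-comm (x ⁻)    (y ⁻)    = cong _⁻ (+-comm x y)

  ⊗-identityʳ : ∀ x → x ⊗ᴳ real 0# ≡ x
  ⊗-identityʳ x = trans (⊗-comm x (real 0#)) (⊗-identityˡ x)

  ⊗-assoc : ∀ x y z → (x ⊗ᴳ y) ⊗ᴳ z ≡ x ⊗ᴳ (y ⊗ᴳ z)
  ⊗-assoc -∞       _        _        = refl
  ⊗-assoc x@(real _) -∞     z        = refl
  ⊗-assoc x@(_ ⁻)  -∞       z        = refl
  ⊗-assoc +∞       -∞       z        = refl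
  ⊗-assoc x        y@(real _) -∞     = trans (⊗-zeroʳ (x ⊗ᴳ y)) (sym (⊗-zeroʳ x))
  ⊗-assoc x        y@(_ ⁻)  -∞       = trans (⊗-zeroʳ (x ⊗ᴳ y)) (sym (⊗-zeroʳ x))
  ⊗-assoc x        +∞       -∞       = trans (⊗-zeroʳ (x ⊗ᴳ +∞)) (sym (⊗-zeroʳ x))
  ⊗-assoc +∞       (real _) (real _) = refl
  ⊗-assoc +∞       (real _) +∞       = refl
  ⊗-assoc +∞       (real _) (_ ⁻)    = refl
  ⊗-assoc +∞       +∞       (real _) = refl
  ⊗-assoc +∞       +∞       +∞       = refl
  ⊗-assoc +∞       +∞       (_ ⁻)    = refl
  ⊗-assoc +∞       (_ ⁻)    (real _) = refl
  ⊗-assoc +∞       (_ ⁻)    +∞       = refl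
  ⊗-assoc +∞       (_ ⁻)    (_ ⁻)    = refl
  ⊗-assoc (real _) +∞       (real _) = refl
  ⊗-assoc (real _) +∞       +∞       = refl
  ⊗-assoc (real _) +∞       (_ ⁻)    = refl
  ⊗-assoc (_ ⁻)    +∞       (real _) = refl
  ⊗-assoc (_ ⁻)    +∞       +∞       = refl
  ⊗-assoc (_ ⁻)    +∞       (_ ⁻)    = refl
  ⊗-assoc (real _) (real _) +∞       = refl
  ⊗-assoc (real _) (_ ⁻)    +∞       = refl
  ⊗-assoc (_ ⁻)    (real _) +∞       = refl
  ⊗-assoc (_ ⁻)    (_ ⁻)    +∞       = refl
  ⊗-assoc (real x) (real y) (real z) = cong real (+-assoc x y z)
  ⊗-assoc (real x) (real y) (z ⁻)    = cong _⁻ (+-assoc x y z)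
  ⊗-assoc (real x) (y ⁻)    (real z) = cong _⁻ (+-assoc x y z)
  ⊗-assoc (real x) (y ⁻)    (z ⁻)    = cong _⁻ (+-assoc x y z)
  ⊗-assoc (x ⁻)    (real y) (real z) = cong _⁻ (+-assoc x y z)
  ⊗-assoc (x ⁻)    (real y) (z ⁻)    = cong _⁻ (+-assoc x y z)
  ⊗-assoc (x ⁻)    (y ⁻)    (real z) = cong _⁻ (+-assoc x y z)
  ⊗-assoc (x ⁻)    (y ⁻)    (z ⁻)    = cong _⁻ (+-assoc x y z)

  -- In this order `α ⁻` is the immediate predecessor of α. A strict bound x < α, expressed by x ⊑
  -- `α ⁻`, stays strict under a real factor. A factor `s ⁻` sends both sides into ℝ⁻, where the
  -- moduli are compared non-strictly.
  ⊗-monoʳ : ∀ b {x y} → x ⊑ y → b ⊗ᴳ x ⊑ b ⊗ᴳ y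
  ⊗-monoʳ -∞       p = ⊑-refl
  ⊗-monoʳ b { -∞ } p = ⊑-trans (⊑-reflexive (⊗-zeroʳ b)) ⊥-least
  ⊗-monoʳ b {real _} { -∞ } (⊑⁺ (inj₁ (AddSupremum.[ () ])))
  ⊗-monoʳ b {_ ⁻}    { -∞ } (⊑⁺ (inj₁ (AddSupremum.[ () ])))
  ⊗-monoʳ b {+∞}     { -∞ } (⊑⁺ (inj₁ ()))
  ⊗-monoʳ +∞ {real _} {real _} p = ⊑-refl
  ⊗-monoʳ +∞ {real _} {+∞}     p = ⊑-refl
  ⊗-monoʳ +∞ {real _} {_ ⁻}    p = ⊑-refl
  ⊗-monoʳ +∞ {+∞}     {real _} p = ⊑-refl
  ⊗-monoʳ +∞ {+∞}     {+∞}     p = ⊑-refl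
  ⊗-monoʳ +∞ {+∞}     {_ ⁻}    p = ⊑-refl
  ⊗-monoʳ +∞ {_ ⁻}    {real _} p = ⊑-refl
  ⊗-monoʳ +∞ {_ ⁻}    {+∞}     p = ⊑-refl
  ⊗-monoʳ +∞ {_ ⁻}    {_ ⁻}    p = ⊑-refl
  ⊗-monoʳ (real s) {_}      {+∞}     p = ⊤-greatest
  ⊗-monoʳ (real s) {real _} {real _} (⊑⁺ p) = ⊑⁺ (≤̄⁺ (+-monoʳ-≤ s (≤̄⁻ p)))
  ⊗-monoʳ (real s) {real _} {_ ⁻}    (⊑⁺ R̄.[ p ]) = ⊑⁺ R̄.[ +-monoʳ-< s p ]
  ⊗-monoʳ (real s) {+∞}     {real _} (⊑⁺ (inj₁ ()))
  ⊗-monoʳ (real s) {+∞}     {_ ⁻}    (⊑⁺ ())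
  ⊗-monoʳ (real s) {_ ⁻}    {real _} (⊑⁺ p) = ⊑⁺ (≤̄⁺ (+-monoʳ-≤ s (≤̄⁻ p)))
  ⊗-monoʳ (real s) {_ ⁻}    {_ ⁻}    (⊑⁺ p) = ⊑⁺ (≤̄⁺ (+-monoʳ-≤ s (≤̄⁻ p)))
  ⊗-monoʳ (s ⁻)    {_}      {+∞}     p = ⊤-greatest
  ⊗-monoʳ (s ⁻)    {real _} {real _} (⊑⁺ p) = ⊑⁺ (≤̄⁺ (+-monoʳ-≤ s (≤̄⁻ p)))
  ⊗-monoʳ (s ⁻)    {real _} {_ ⁻}    (⊑⁺ R̄.[ p ]) = ⊑⁺ (≤̄⁺ (inj₁ (+-monoʳ-< s p)))
  ⊗-monoʳ (s ⁻)    {+∞}     {real _} (⊑⁺ (inj₁ ()))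
  ⊗-monoʳ (s ⁻)    {+∞}     {_ ⁻}    (⊑⁺ ())
  ⊗-monoʳ (s ⁻)    {_ ⁻}    {real _} (⊑⁺ p) = ⊑⁺ (≤̄⁺ (+-monoʳ-≤ s (≤̄⁻ p)))
  ⊗-monoʳ (s ⁻)    {_ ⁻}    {_ ⁻}    (⊑⁺ p) = ⊑⁺ (≤̄⁺ (+-monoʳ-≤ s (≤̄⁻ p)))

  -- A monotone map between total orders preserves maxima.
  ⊗-distribˡ : ∀ b x y → b ⊗ᴳ (x ⊕ᴳ y) ≡ b ⊗ᴳ x ⊕ᴳ b ⊗ᴳ y
  ⊗-distribˡ b = Maxᴳ.mono-≤-distrib-⊔ {b ⊗ᴳ_} (cong (b ⊗ᴳ_))
    (λ {x} {y} p → ⊑⁻ (⊗-monoʳ b {x} {y} (⊑⁺ p)))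

  ⊗-distribʳ : ∀ x b c → (b ⊕ᴳ c) ⊗ᴳ x ≡ b ⊗ᴳ x ⊕ᴳ c ⊗ᴳ x
  ⊗-distribʳ x b c = trans (⊗-comm (b ⊕ᴳ c) x)
    (trans (⊗-distribˡ x b c) (cong₂ _⊕ᴳ_ (⊗-comm x b) (⊗-comm x c)))

  -- The embedding of Rmax in 𝔾 and division by real scalars.

  embed-mono : ∀ {x y} → x ≤ y → embed x ⊑ embed y
  embed-mono (inj₁ p)    = ⊑⁺ (inj₁ AddSupremum.[ p ])
  embed-mono (inj₂ refl) = ⊑-refl

  embed-cancel : ∀ {x y} → embed x ⊑ embed y → x ≤ y
  embed-cancel (⊑⁺ (inj₁ AddSupremum.[ p ])) = inj₁ p
  embed-cancel (⊑⁺ (inj₂ refl))              = inj₂ refl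

  embed-injective : ∀ {x y} → embed x ≡ embed y → x ≡ y
  embed-injective refl = refl

  embed-⊕ : ∀ x y → embed (x ⊕ y) ≡ embed x ⊕ᴳ embed y
  embed-⊕ x y with TotalOrder.total Rmax-totalOrder x y
  ... | inj₁ x≤y = trans (cong embed (Maxᴿ.x≤y⇒x⊔y≈y x≤y)) (sym (x⊑y⇒x⊕y≡y (embed-mono x≤y)))
  ... | inj₂ y≤x = trans (cong embed (Maxᴿ.x≤y⇒y⊔x≈y y≤x))
    (sym (trans (⊕-comm (embed x) (embed y)) (x⊑y⇒x⊕y≡y (embed-mono y≤x))))

  embed-⊗ : ∀ x y → embed (x ⊗ y) ≡ embed x ⊗ᴳ embed y
  embed-⊗ ⊥₋        y         = refl
  embed-⊗ Inf.[ _ ] ⊥₋        = refl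
  embed-⊗ Inf.[ _ ] Inf.[ _ ] = refl

  real⋢⊥ : ∀ {r} → ¬ real r ⊑ -∞
  real⋢⊥ (⊑⁺ (inj₁ AddSupremum.[ () ]))

  -r⊗[r⊗x]≡x : ∀ r x → real (- r) ⊗ᴳ (real r ⊗ᴳ x) ≡ x
  -r⊗[r⊗x]≡x r x = trans (sym (⊗-assoc (real (- r)) (real r) x))
    (trans (cong (λ s → real s ⊗ᴳ x) (-‿inverseˡ r)) (⊗-identityˡ x))

  r⊗[-r⊗x]≡x : ∀ r x → real r ⊗ᴳ (real (- r) ⊗ᴳ x) ≡ x
  r⊗[-r⊗x]≡x r x = trans (sym (⊗-assoc (real r) (real (- r)) x))
    (trans (cong (λ s → real s ⊗ᴳ x) (-‿inverseʳ r)) (⊗-identityˡ x))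

  -- Real scalars are invertible in 𝔾. A real coefficient on the left can therefore be moved to the
  -- right, which brings inequalities to a form with a bare variable on the left.
  r⊗x⊑y⇒x⊑-r⊗y : ∀ r {x y} → real r ⊗ᴳ x ⊑ y → x ⊑ real (- r) ⊗ᴳ y
  r⊗x⊑y⇒x⊑-r⊗y r {x} p = ⊑-trans (⊑-reflexive (sym (-r⊗[r⊗x]≡x r x))) (⊗-monoʳ (real (- r)) p)

  x⊑-r⊗y⇒r⊗x⊑y : ∀ r {x y} → x ⊑ real (- r) ⊗ᴳ y → real r ⊗ᴳ x ⊑ y
  x⊑-r⊗y⇒r⊗x⊑y r {y = y} p = ⊑-trans (⊗-monoʳ (real r) p) (⊑-reflexive (r⊗[-r⊗x]≡x r y))

  ⊗-monoˡ : ∀ x {b c} → b ⊑ c → b ⊗ᴳ x ⊑ c ⊗ᴳ x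
  ⊗-monoˡ x {b} {c} p = subst₂ _⊑_ (⊗-comm x b) (⊗-comm x c) (⊗-monoʳ x p)

  -- An upper bound `u` in 𝔾 on an unknown in Rmax may be replaced by a value of
  -- that unknown without losing `c`; density is needed when `u` and `b` are both of the form α⁻.
  attain : ∀ c b u → embed c ⊑ b ⊗ᴳ u → ∃[ t ] embed t ⊑ u × embed c ⊑ b ⊗ᴳ embed t
  attain ⊥₋ b u p = ⊥₋ , ⊥-least , ⊥-least
  attain Inf.[ r ] -∞ u p = contradiction p real⋢⊥
  attain Inf.[ r ] b -∞ p = contradiction (⊑-trans p (⊑-reflexive (⊗-zeroʳ b))) real⋢⊥
  attain Inf.[ r ] b (real s) p = Inf.[ s ] , ⊑-refl , p
  attain Inf.[ r ] +∞ +∞ p = Inf.[ r ] , ⊤-greatest , ⊤-greatest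
  attain Inf.[ r ] (real s) +∞ p =
    Inf.[ r + - s ] , ⊤-greatest , ⊑-reflexive (cong real (sym (x+[y-x]≡y s r)))
  -- The coefficient `β ⁻` demands r < β + t, so t is chosen with β + t = m for some m above r.
  attain Inf.[ r ] (β ⁻) +∞ p with m , r<m ← unboundedAbove r =
    Inf.[ m + - β ] , ⊤-greatest , ⊑⁺ R̄.[ subst (r <ℝ_) (sym (x+[y-x]≡y β m)) r<m ]
  -- The coefficient +∞ demands only that t be finite, and the bound `α ⁻` that t < α.
  attain Inf.[ r ] +∞ (α ⁻) p with q , q<α ← unboundedBelow α =
    Inf.[ q ] , ⊑⁺ R̄.[ q<α ] , ⊤-greatest
  attain Inf.[ r ] (real s) (α ⁻) (⊑⁺ R̄.[ p ]) =
    Inf.[ r + - s ] ,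
    ⊑⁺ R̄.[ subst (r + - s <ℝ_) (x+y-x≡y s α) (+-monoˡ-< (- s) p) ] ,
    ⊑-reflexive (cong real (sym (x+[y-x]≡y s r)))
  attain Inf.[ r ] (β ⁻) (α ⁻) (⊑⁺ R̄.[ p ]) with m , r<m , m<β+α ← dense p =
    Inf.[ m + - β ] ,
    ⊑⁺ R̄.[ subst (m + - β <ℝ_) (x+y-x≡y β α) (+-monoˡ-< (- β) m<β+α) ] ,
    ⊑⁺ R̄.[ subst (r <ℝ_) (sym (x+[y-x]≡y β m)) r<m ]

  private variable
    m n : ℕ

  -- Linear forms over 𝔾.

  dot : Vec 𝔾 n → Vec 𝔾 n → 𝔾
  dot b v = foldr′ _⊕ᴳ_ -∞ (zipWith _⊗ᴳ_ b v)

  dot-comm : ∀ (b v : Vec 𝔾 n) → dot b v ≡ dot v b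
  dot-comm []      []      = refl
  dot-comm (b ∷ bs) (v ∷ vs) = cong₂ _⊕ᴳ_ (⊗-comm b v) (dot-comm bs vs)

  dot-zipWith-⊕ : ∀ (b c v : Vec 𝔾 n) → dot (zipWith _⊕ᴳ_ b c) v ≡ dot b v ⊕ᴳ dot c v
  dot-zipWith-⊕ []       []       []       = refl
  dot-zipWith-⊕ (b ∷ bs) (c ∷ cs) (v ∷ vs) = begin
    (b ⊕ᴳ c) ⊗ᴳ v ⊕ᴳ dot (zipWith _⊕ᴳ_ bs cs) vs
      ≡⟨ cong₂ _⊕ᴳ_ (⊗-distribʳ v b c) (dot-zipWith-⊕ bs cs vs) ⟩
    (b ⊗ᴳ v ⊕ᴳ c ⊗ᴳ v) ⊕ᴳ (dot bs vs ⊕ᴳ dot cs vs)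
      ≡⟨ ⊕-interchange (b ⊗ᴳ v) (c ⊗ᴳ v) (dot bs vs) (dot cs vs) ⟩
    (b ⊗ᴳ v ⊕ᴳ dot bs vs) ⊕ᴳ (c ⊗ᴳ v ⊕ᴳ dot cs vs) ∎
    where open ≡-Reasoning

  dot-map-⊗ : ∀ s (b v : Vec 𝔾 n) → dot (map (s ⊗ᴳ_) b) v ≡ s ⊗ᴳ dot b v
  dot-map-⊗ s []       []       = sym (⊗-zeroʳ s)
  dot-map-⊗ s (b ∷ bs) (v ∷ vs) =
    trans (cong₂ _⊕ᴳ_ (⊗-assoc s b v) (dot-map-⊗ s bs vs)) (sym (⊗-distribˡ s (b ⊗ᴳ v) (dot bs vs)))

  dot-++ : ∀ (b v : Vec 𝔾 m) (c w : Vec 𝔾 n) → dot (b ++ c) (v ++ w) ≡ dot b v ⊕ᴳ dot c w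
  dot-++ []       []       c w = sym (⊕-identityˡ (dot c w))
  dot-++ (b ∷ bs) (v ∷ vs) c w =
    trans (cong (b ⊗ᴳ v ⊕ᴳ_) (dot-++ bs vs c w)) (sym (⊕-assoc (b ⊗ᴳ v) (dot bs vs) (dot c w)))

  𝟎 : Vec 𝔾 n
  𝟎 = replicate _ -∞

  dot-𝟎 : ∀ (v : Vec 𝔾 n) → dot 𝟎 v ≡ -∞
  dot-𝟎 []       = refl
  dot-𝟎 (v ∷ vs) = trans (⊕-identityˡ (dot 𝟎 vs)) (dot-𝟎 vs)

  single : Fin n → 𝔾 → Vec 𝔾 n
  single i b = 𝟎 [ i ]≔ b

  dot-single : ∀ i b (v : Vec 𝔾 n) → dot (single i b) v ≡ b ⊗ᴳ lookup v i
  dot-single zero    b (v ∷ vs) = trans (cong (b ⊗ᴳ v ⊕ᴳ_) (dot-𝟎 vs)) (⊕-identityʳ (b ⊗ᴳ v))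
  dot-single (suc i) b (v ∷ vs) = trans (⊕-identityˡ (dot (single i b) vs)) (dot-single i b vs)

  dot-lub : ∀ (b v : Vec 𝔾 n) {c} → (∀ i → lookup b i ⊗ᴳ lookup v i ⊑ c) → dot b v ⊑ c
  dot-lub []       []       p = ⊥-least
  dot-lub (b ∷ bs) (v ∷ vs) p = ⊕-lub (p zero) (dot-lub bs vs (p ∘ suc))

  term⊑dot : ∀ (b v : Vec 𝔾 n) i → lookup b i ⊗ᴳ lookup v i ⊑ dot b v
  term⊑dot (b ∷ bs) (v ∷ vs) zero    = x⊑x⊕y (b ⊗ᴳ v) (dot bs vs)
  term⊑dot (b ∷ bs) (v ∷ vs) (suc i) = ⊑-trans (term⊑dot bs vs i) (y⊑x⊕y (b ⊗ᴳ v) (dot bs vs))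

  -- Iterates `⊑-split`. The recursion ends at the empty sum -∞, which leaves c ⊑ -∞ as an
  -- alternative of its own.
  dot-attained : ∀ (b v : Vec 𝔾 n) {c} → c ⊑ dot b v →
                 c ⊑ -∞ ⊎ ∃[ i ] c ⊑ lookup b i ⊗ᴳ lookup v i
  dot-attained []       []       p = inj₁ p
  dot-attained (b ∷ bs) (v ∷ vs) p with ⊑-split (b ⊗ᴳ v) (dot bs vs) p
  ... | inj₁ q = inj₂ (zero , q)
  ... | inj₂ q with dot-attained bs vs q
  ...   | inj₁ r       = inj₁ r
  ...   | inj₂ (i , r) = inj₂ (suc i , r)

  ⊤s : Vec 𝔾 n
  ⊤s = replicate _ +∞

  ⊤≡dot-⊤s : ∀ (x : Point n) {i r} → lookup x i ≡ Inf.[ r ] → +∞ ⊑ dot ⊤s (map embed x)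
  ⊤≡dot-⊤s x {i} {r} eq = ⊑-trans
    (⊑-reflexive (sym (cong₂ _⊗ᴳ_ (lookup-replicate i +∞) (trans (lookup-map i embed x) (cong embed eq)))))
    (term⊑dot ⊤s (map embed x) i)

  -- An inequality (i , b) reads 𝐱ᵢ ≤ ⨁ⱼ bⱼ 𝐱ⱼ.
  Inequality : ℕ → Set
  Inequality n = Fin n × Vec 𝔾 n

  System : ℕ → Set
  System n = List (Inequality n)

  infix 4 _⊨_
  _⊨_ : Point n → Inequality n → Set
  x ⊨ (i , b) = embed (lookup x i) ⊑ dot b (map embed x)

  Solution : Point n → System n → Set
  Solution x S = All (x ⊨_) S

  -- Fourier–Motzkin elimination

  -- The borderline coefficient is `0# ⁻`: it turns a finite t into `t ⁻`, which is strictly below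
  -- t, so it falls on the second side together with everything else below 0.
  0⊑b⊎bt<t : ∀ b → real 0# ⊑ b ⊎ (∀ t → embed t ⊑ b ⊗ᴳ embed t → embed t ⊑ -∞)
  0⊑b⊎bt<t -∞       = inj₂ λ _ p → p
  0⊑b⊎bt<t +∞       = inj₁ ⊤-greatest
  0⊑b⊎bt<t (real s) with compare 0# s
  ... | tri< 0<s _ _ = inj₁ (⊑⁺ (≤̄⁺ (inj₁ 0<s)))
  ... | tri≈ _ 0≡s _ = inj₁ (⊑⁺ (≤̄⁺ (inj₂ 0≡s)))
  ... | tri> _ _ s<0 = inj₂ λ where
    ⊥₋        _      → ⊑-refl
    Inf.[ r ] (⊑⁺ p) → contradiction (≤̄⁻ p) (<⇒≱ (subst (s + r <ℝ_) (+-identityˡ r) (+-monoˡ-< r s<0)))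
  0⊑b⊎bt<t (s ⁻) with compare 0# s
  ... | tri< 0<s _ _ = inj₁ (⊑⁺ R̄.[ 0<s ])
  ... | tri≈ _ refl _ = inj₂ λ where
    ⊥₋        _            → ⊑-refl
    Inf.[ r ] (⊑⁺ R̄.[ p ]) → contradiction p (<-irrefl (sym (+-identityˡ r)))
  ... | tri> _ _ s<0 = inj₂ λ where
    ⊥₋        _            → ⊑-refl
    Inf.[ r ] (⊑⁺ R̄.[ p ]) →
      contradiction (inj₁ p) (<⇒≱ (subst (s + r <ℝ_) (+-identityˡ r) (+-monoˡ-< r s<0)))

  -- The variable t to be eliminated comes first. Since b t < t when 0 ⋢ b (unless t = -∞), a bound
  -- t ≤ b t ⊕ u amounts to t ≤ u; otherwise it is vacuous.
  uppers : System (suc n) → List (Vec 𝔾 n)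
  uppers []                     = []
  uppers ((zero , b ∷ c) ∷ S) with 0⊑b⊎bt<t b
  ... | inj₁ _ = uppers S
  ... | inj₂ _ = c ∷ uppers S
  uppers ((suc _ , _) ∷ S)      = uppers S

  lowers : System (suc n) → List (Fin n × Vec 𝔾 (suc n))
  lowers []                   = []
  lowers ((zero , _) ∷ S)     = lowers S
  lowers ((suc i , b) ∷ S)    = (i , b) ∷ lowers S

  Below : Point n → 𝔾 → Vec 𝔾 n → Set
  Below x t u = t ⊑ dot u (map embed x)

  Above : Point n → 𝔾 → Fin n × Vec 𝔾 (suc n) → Set
  Above x t (i , b) = embed (lookup x i) ⊑ dot b (t ∷ map embed x)

  solution⇒below : ∀ t (x : Point n) S → Solution (t ∷ x) S → All (Below x (embed t)) (uppers S)
  solution⇒below t x []                   []       = []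
  solution⇒below t x ((zero , b ∷ c) ∷ S) (p ∷ ps) with 0⊑b⊎bt<t b
  ... | inj₁ _ = solution⇒below t x S ps
  ... | inj₂ q with ⊑-split (b ⊗ᴳ embed t) (dot c (map embed x)) p
  -- Here t is bounded by its own term b t, which forces t = -∞, and -∞ lies below every bound.
  ...   | inj₁ r = ⊑-trans (q t r) ⊥-least ∷ solution⇒below t x S ps
  ...   | inj₂ r = r ∷ solution⇒below t x S ps
  solution⇒below t x ((suc i , b) ∷ S)    (p ∷ ps) = solution⇒below t x S ps

  solution⇒above : ∀ t (x : Point n) S → Solution (t ∷ x) S → All (Above x (embed t)) (lowers S)
  solution⇒above t x []                []       = []
  solution⇒above t x ((zero , b) ∷ S)  (p ∷ ps) = solution⇒above t x S ps
  solution⇒above t x ((suc i , b) ∷ S) (p ∷ ps) = p ∷ solution⇒above t x S ps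

  below∧above⇒solution : ∀ t (x : Point n) S → All (Below x (embed t)) (uppers S) →
                         All (Above x (embed t)) (lowers S) → Solution (t ∷ x) S
  below∧above⇒solution t x []                   us       ls       = []
  below∧above⇒solution t x ((zero , b ∷ c) ∷ S) us       ls with 0⊑b⊎bt<t b
  ... | inj₁ 0⊑b = t⊑ ∷ below∧above⇒solution t x S us ls
    where
    t⊑ : embed t ⊑ b ⊗ᴳ embed t ⊕ᴳ dot c (map embed x)
    t⊑ = ⊑-trans (⊑-reflexive (sym (⊗-identityˡ (embed t))))
           (⊑-trans (⊗-monoˡ (embed t) 0⊑b) (x⊑x⊕y (b ⊗ᴳ embed t) (dot c (map embed x))))
  below∧above⇒solution t x ((zero , b ∷ c) ∷ S) (u ∷ us) ls | inj₂ _ =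
    ⊑-trans u (y⊑x⊕y (b ⊗ᴳ embed t) (dot c (map embed x))) ∷ below∧above⇒solution t x S us ls
  below∧above⇒solution t x ((suc i , b) ∷ S)    us       (l ∷ ls) =
    l ∷ below∧above⇒solution t x S us ls

  resolve : Fin n × Vec 𝔾 (suc n) → Vec 𝔾 n → Inequality n
  resolve (i , b) u = i , zipWith _⊕ᴳ_ (map (head b ⊗ᴳ_) u) (tail b)

  dot-resolve : ∀ q (u v : Vec 𝔾 n) → dot (proj₂ (resolve q u)) v ≡ dot (proj₂ q) (dot u v ∷ v)
  dot-resolve (i , b ∷ c) u v =
    trans (dot-zipWith-⊕ (map (b ⊗ᴳ_) u) c v) (cong (_⊕ᴳ dot c v) (dot-map-⊗ b u v))

  -- Each upper bound u is substituted for t in each lower bound. The extra bound ⊤s is vacuous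
  -- unless 𝐱 is identically -∞; it makes the list of upper bounds nonempty.
  eliminate : System (suc n) → System n
  eliminate S = List.concatMap (λ q → List.map (resolve q) (⊤s ∷ uppers S)) (lowers S)

  Above-mono : ∀ (x : Point n) {t u} → t ⊑ u → ∀ q → Above x t q → Above x u q
  Above-mono x p (_ , b ∷ c) a = ⊑-trans a (⊕-mono (⊗-monoʳ b p) (⊑-refl {dot c (map embed x)}))

  Above⇒resolve : ∀ (x : Point n) {t} u q → Below x t u → Above x t q → x ⊨ resolve q u
  Above⇒resolve x u q p a =
    ⊑-trans (Above-mono x p q a) (⊑-reflexive (sym (dot-resolve q u (map embed x))))

  resolve⇒Above : ∀ (x : Point n) u q → x ⊨ resolve q u → Above x (dot u (map embed x)) q
  resolve⇒Above x u q p = ⊑-trans p (⊑-reflexive (dot-resolve q u (map embed x)))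

  -- If the left side 𝐱ᵢ is -∞ the conclusion is trivial. If it is finite, `⊤s` evaluates to +∞ at 𝐱
  -- and thus bounds every t.
  Above⇒resolve-⊤s : ∀ (x : Point n) {t} q → Above x t q → x ⊨ resolve q ⊤s
  Above⇒resolve-⊤s x {t} q a with lookup x (proj₁ q) in eq
  ... | ⊥₋        = ⊥-least
  ... | Inf.[ r ] = subst (λ y → embed y ⊑ dot (proj₂ (resolve q ⊤s)) (map embed x)) eq
    (Above⇒resolve x ⊤s q (⊑-trans (⊤-greatest {t}) (⊤≡dot-⊤s x eq))
      (subst (λ y → embed y ⊑ dot (proj₂ q) (t ∷ map embed x)) (sym eq) a))

  eliminate-sound : ∀ t (x : Point n) S → Solution (t ∷ x) S → Solution x (eliminate S)
  eliminate-sound t x S p =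
    All.concat⁺ (All.map⁺ (All.map (λ {q} a → All.map⁺
      (Above⇒resolve-⊤s x q a ∷ All.map (λ {u} b → Above⇒resolve x u q b a) (solution⇒below t x S p)))
      (solution⇒above t x S p)))

  attain-Above : ∀ (x : Point n) u q → Above x u q → ∃[ t ] embed t ⊑ u × Above x (embed t) q
  attain-Above x u (i , b ∷ c) a with ⊑-split (b ⊗ᴳ u) (dot c (map embed x)) a
  -- The terms without t already reach the lower bound, so the smallest value of t will do.
  ... | inj₂ p = ⊥₋ , ⊥-least , ⊑-trans p (y⊑x⊕y (b ⊗ᴳ -∞) (dot c (map embed x)))
  ... | inj₁ p with t , t⊑u , q ← attain (lookup x i) b u p =
    t , t⊑u , ⊑-trans q (x⊑x⊕y (b ⊗ᴳ embed t) (dot c (map embed x)))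

  -- The inequalities `Above` are preserved when t grows. Hence the maximum of values that serve
  -- them one at a time serves all of them, and it stays below u.
  attain-All : ∀ (x : Point n) u qs → All (Above x u) qs →
               ∃[ t ] embed t ⊑ u × All (Above x (embed t)) qs
  attain-All x u []       []       = ⊥₋ , ⊥-least , []
  attain-All x u (q ∷ qs) (a ∷ as)
    with t  , t⊑u  , a′  ← attain-Above x u q a
       | t′ , t′⊑u , as′ ← attain-All x u qs as =
    t ⊕ t′ ,
    subst (_⊑ u) (sym (embed-⊕ t t′)) (⊕-lub t⊑u t′⊑u) ,
    Above-mono x (raise (x⊑x⊕y (embed t) (embed t′))) q a′ ∷
    All.map (λ {q} → Above-mono x (raise (y⊑x⊕y (embed t) (embed t′))) q) as′
    where
    raise : ∀ {s} → s ⊑ embed t ⊕ᴳ embed t′ → s ⊑ embed (t ⊕ t′)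
    raise = subst (_ ⊑_) (sym (embed-⊕ t t′))

  -- The least of the upper bounds satisfies every lower bound, because the resolved inequalities
  -- say so for each upper bound. It is a value in 𝔾, possibly outside Rmax, and `attain-All`
  -- replaces it by a genuine value of t.
  eliminate-complete : ∀ (x : Point n) S → Solution x (eliminate S) → ∃[ t ] Solution (t ∷ x) S
  eliminate-complete {n} x S p =
    let t , t⊑u , as = attain-All x (value least) (lowers S) lowers-Above in
    t , below∧above⇒solution t x S (All.map (λ u≥least → ⊑-trans t⊑u (⊑⁺ u≥least)) least-minimal) as
    where
    value : Vec 𝔾 n → 𝔾
    value u = dot u (map embed x)
    least : Vec 𝔾 n
    least = argmin value ⊤s (uppers S)
    least-minimal : All (λ u → value least ≤ᴳ value u) (uppers S)
    least-minimal = f[argmin]≤f[xs] {f = value} ⊤s (uppers S)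
    least-Above : ∀ q → All (λ u → x ⊨ resolve q u) (⊤s ∷ uppers S) → Above x (value least) q
    least-Above q (r ∷ rs) = argmin-all value {P = λ u → Above x (value u) q}
      (resolve⇒Above x ⊤s q r) (All.map (λ {u} → resolve⇒Above x u q) rs)
    lowers-Above : All (Above x (value least)) (lowers S)
    lowers-Above = All.map (λ {q} → least-Above q ∘ All.map⁻) (All.map⁻ (All.concat⁻ p))

  eliminateAll : ∀ m → System (m ℕ.+ n) → System n
  eliminateAll zero    S = S
  eliminateAll (suc m) S = eliminateAll m (eliminate S)

  eliminateAll-sound : ∀ (y : Point m) (x : Point n) S → Solution (y ++ x) S → Solution x (eliminateAll m S)
  eliminateAll-sound []       x S p = p
  eliminateAll-sound (t ∷ y) x S p = eliminateAll-sound y x (eliminate S) (eliminate-sound t (y ++ x) S p)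

  eliminateAll-complete : ∀ m (x : Point n) S → Solution x (eliminateAll m S) →
                          ∃ λ (y : Point m) → Solution (y ++ x) S
  eliminateAll-complete zero    x S p = [] , p
  eliminateAll-complete (suc m) x S p
    with y , q ← eliminateAll-complete m x (eliminate S) p
    with t , r ← eliminate-complete (y ++ x) S q = t ∷ y , r

  -- Minkowski sums

  lookup-ext : ∀ {A : Set} {xs ys : Vec A n} → (∀ i → lookup xs i ≡ lookup ys i) → xs ≡ ys
  lookup-ext {xs = xs} {ys} eq =
    trans (sym (tabulate∘lookup xs)) (trans (tabulate-cong eq) (tabulate∘lookup ys))

  dot-++-++ : ∀ (a b c : Vec 𝔾 n) (z w x : Point n) →
    dot (a ++ (b ++ c)) (map embed (z ++ (w ++ x))) ≡
    dot a (map embed z) ⊕ᴳ (dot b (map embed w) ⊕ᴳ dot c (map embed x))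
  dot-++-++ a b c z w x = begin
    dot (a ++ (b ++ c)) (map embed (z ++ (w ++ x)))
      ≡⟨ cong (dot (a ++ (b ++ c)))
             (trans (map-++ embed z (w ++ x)) (cong (map embed z ++_) (map-++ embed w x))) ⟩
    dot (a ++ (b ++ c)) (map embed z ++ (map embed w ++ map embed x))
      ≡⟨ dot-++ a (map embed z) (b ++ c) _ ⟩
    dot a (map embed z) ⊕ᴳ dot (b ++ c) (map embed w ++ map embed x)
      ≡⟨ cong (dot a (map embed z) ⊕ᴳ_) (dot-++ b (map embed w) c (map embed x)) ⟩
    dot a (map embed z) ⊕ᴳ (dot b (map embed w) ⊕ᴳ dot c (map embed x)) ∎
    where open ≡-Reasoning

  module Minkowski {n : ℕ} where

    -- The variables are ordered z, w, x, so that the two summands form the leading blocks, which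
    -- `eliminateAll` removes one after the other.
    inˡ inᵐ inʳ : Fin n → Fin (n ℕ.+ (n ℕ.+ n))
    inˡ i = i ↑ˡ (n ℕ.+ n)
    inᵐ i = n ↑ʳ (i ↑ˡ n)
    inʳ i = n ↑ʳ (n ↑ʳ i)

    𝐨 : Vec 𝔾 n
    𝐨 = 𝟎

    unit : Fin n → Vec 𝔾 n
    unit i = single i (real 0#)

    onˡ onᵐ : Inequality n → Inequality (n ℕ.+ (n ℕ.+ n))
    onˡ (i , b) = inˡ i , b ++ (𝐨 ++ 𝐨)
    onᵐ (i , b) = inᵐ i , 𝐨 ++ (b ++ 𝐨)

    -- Together these encode the equation x = z ⊕ w by inequalities with a single variable on the
    -- left.
    z≤x w≤x x≤z⊕w : Fin n → Inequality (n ℕ.+ (n ℕ.+ n))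
    z≤x   i = inˡ i , 𝐨 ++ (𝐨 ++ unit i)
    w≤x   i = inᵐ i , 𝐨 ++ (𝐨 ++ unit i)
    x≤z⊕w i = inʳ i , unit i ++ (unit i ++ 𝐨)

    joint : System n → System n → System (n ℕ.+ (n ℕ.+ n))
    joint C D = List.map onˡ C List.++ List.map onᵐ D List.++
      List.tabulate z≤x List.++ List.tabulate w≤x List.++ List.tabulate x≤z⊕w

    module _ (z w x : Point n) where

      private
        v : Point (n ℕ.+ (n ℕ.+ n))
        v = z ++ (w ++ x)
        ẑ ŵ x̂ : Vec 𝔾 n
        ẑ = map embed z
        ŵ = map embed w
        x̂ = map embed x
        open ≡-Reasoning

      lookup-inˡ : ∀ i → lookup v (inˡ i) ≡ lookup z i
      lookup-inˡ = lookup-++ˡ z (w ++ x)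

      lookup-inᵐ : ∀ i → lookup v (inᵐ i) ≡ lookup w i
      lookup-inᵐ i = trans (lookup-++ʳ z (w ++ x) (i ↑ˡ n)) (lookup-++ˡ w x i)

      lookup-inʳ : ∀ i → lookup v (inʳ i) ≡ lookup x i
      lookup-inʳ i = trans (lookup-++ʳ z (w ++ x) (n ↑ʳ i)) (lookup-++ʳ w x i)

      dotˡ : ∀ b → dot (b ++ (𝐨 ++ 𝐨)) (map embed v) ≡ dot b ẑ
      dotˡ b = begin
        dot (b ++ (𝐨 ++ 𝐨)) (map embed v)   ≡⟨ dot-++-++ b 𝐨 𝐨 z w x ⟩
        dot b ẑ ⊕ᴳ (dot 𝐨 ŵ ⊕ᴳ dot 𝐨 x̂)
          ≡⟨ cong₂ (λ s t → dot b ẑ ⊕ᴳ (s ⊕ᴳ t)) (dot-𝟎 ŵ) (dot-𝟎 x̂) ⟩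
        dot b ẑ ⊕ᴳ (-∞ ⊕ᴳ -∞)               ≡⟨ ⊕-identityʳ (dot b ẑ) ⟩
        dot b ẑ                             ∎

      dotᵐ : ∀ b → dot (𝐨 ++ (b ++ 𝐨)) (map embed v) ≡ dot b ŵ
      dotᵐ b = begin
        dot (𝐨 ++ (b ++ 𝐨)) (map embed v)   ≡⟨ dot-++-++ 𝐨 b 𝐨 z w x ⟩
        dot 𝐨 ẑ ⊕ᴳ (dot b ŵ ⊕ᴳ dot 𝐨 x̂)
          ≡⟨ cong₂ (λ s t → s ⊕ᴳ (dot b ŵ ⊕ᴳ t)) (dot-𝟎 ẑ) (dot-𝟎 x̂) ⟩
        -∞ ⊕ᴳ (dot b ŵ ⊕ᴳ -∞)               ≡⟨ ⊕-identityˡ (dot b ŵ ⊕ᴳ -∞) ⟩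
        dot b ŵ ⊕ᴳ -∞                       ≡⟨ ⊕-identityʳ (dot b ŵ) ⟩
        dot b ŵ                             ∎

      dot-unit : ∀ i (u : Point n) → dot (unit i) (map embed u) ≡ embed (lookup u i)
      dot-unit i u = trans (dot-single i (real 0#) (map embed u))
        (trans (⊗-identityˡ (lookup (map embed u) i)) (lookup-map i embed u))

      dotʳ-unit : ∀ i → dot (𝐨 ++ (𝐨 ++ unit i)) (map embed v) ≡ embed (lookup x i)
      dotʳ-unit i = begin
        dot (𝐨 ++ (𝐨 ++ unit i)) (map embed v)     ≡⟨ dot-++-++ 𝐨 𝐨 (unit i) z w x ⟩
        dot 𝐨 ẑ ⊕ᴳ (dot 𝐨 ŵ ⊕ᴳ dot (unit i) x̂)
          ≡⟨ cong₂ (λ s t → s ⊕ᴳ (t ⊕ᴳ dot (unit i) x̂)) (dot-𝟎 ẑ) (dot-𝟎 ŵ) ⟩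
        -∞ ⊕ᴳ (-∞ ⊕ᴳ dot (unit i) x̂)               ≡⟨ ⊕-identityˡ (-∞ ⊕ᴳ dot (unit i) x̂) ⟩
        -∞ ⊕ᴳ dot (unit i) x̂                       ≡⟨ ⊕-identityˡ (dot (unit i) x̂) ⟩
        dot (unit i) x̂                             ≡⟨ dot-unit i x ⟩
        embed (lookup x i)                         ∎

      dotˡᵐ-unit : ∀ i → dot (unit i ++ (unit i ++ 𝐨)) (map embed v) ≡
                         embed (lookup z i) ⊕ᴳ embed (lookup w i)
      dotˡᵐ-unit i = begin
        dot (unit i ++ (unit i ++ 𝐨)) (map embed v)        ≡⟨ dot-++-++ (unit i) (unit i) 𝐨 z w x ⟩
        dot (unit i) ẑ ⊕ᴳ (dot (unit i) ŵ ⊕ᴳ dot 𝐨 x̂)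
          ≡⟨ cong (λ s → dot (unit i) ẑ ⊕ᴳ (dot (unit i) ŵ ⊕ᴳ s)) (dot-𝟎 x̂) ⟩
        dot (unit i) ẑ ⊕ᴳ (dot (unit i) ŵ ⊕ᴳ -∞)
          ≡⟨ cong (dot (unit i) ẑ ⊕ᴳ_) (⊕-identityʳ (dot (unit i) ŵ)) ⟩
        dot (unit i) ẑ ⊕ᴳ dot (unit i) ŵ                   ≡⟨ cong₂ _⊕ᴳ_ (dot-unit i z) (dot-unit i w) ⟩
        embed (lookup z i) ⊕ᴳ embed (lookup w i)           ∎

      embed-lookup-⊕ : ∀ i → embed (lookup (zipWith _⊕_ z w) i) ≡
                             embed (lookup z i) ⊕ᴳ embed (lookup w i)
      embed-lookup-⊕ i =
        trans (cong embed (lookup-zipWith _⊕_ i z w)) (embed-⊕ (lookup z i) (lookup w i))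

      joint-sound : ∀ C D → Solution z C → Solution w D → x ≡ zipWith _⊕_ z w → Solution v (joint C D)
      joint-sound C D zC wD x≡z⊕w =
        All.++⁺ (All.map⁺ (All.map (λ {(i , b)} → moveˡ i (dotˡ b)) zC)) (
        All.++⁺ (All.map⁺ (All.map (λ {(i , b)} → moveᵐ i (dotᵐ b)) wD)) (
        All.++⁺ (All.tabulate⁺ λ i → moveˡ i (trans (dotʳ-unit i) (x≡ i))
                  (x⊑x⊕y (embed (lookup z i)) (embed (lookup w i)))) (
        All.++⁺ (All.tabulate⁺ λ i → moveᵐ i (trans (dotʳ-unit i) (x≡ i))
                  (y⊑x⊕y (embed (lookup z i)) (embed (lookup w i)))) (
        All.tabulate⁺ λ i → ⊑-reflexive (trans
          (cong embed (lookup-inʳ i)) (trans (x≡ i) (sym (dotˡᵐ-unit i))))))))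
        where
        moveˡ : ∀ i {s t} → s ≡ t → embed (lookup z i) ⊑ t → embed (lookup v (inˡ i)) ⊑ s
        moveˡ i eq = subst₂ _⊑_ (cong embed (sym (lookup-inˡ i))) (sym eq)
        moveᵐ : ∀ i {s t} → s ≡ t → embed (lookup w i) ⊑ t → embed (lookup v (inᵐ i)) ⊑ s
        moveᵐ i eq = subst₂ _⊑_ (cong embed (sym (lookup-inᵐ i))) (sym eq)
        x≡ : ∀ i → embed (lookup x i) ≡ embed (lookup z i) ⊕ᴳ embed (lookup w i)
        x≡ i = trans (cong (λ y → embed (lookup y i)) x≡z⊕w) (embed-lookup-⊕ i)

      joint-complete : ∀ C D → Solution v (joint C D) →
                       Solution z C × Solution w D × x ≡ zipWith _⊕_ z w
      joint-complete C D p
        with zC , p ← All.++⁻ (List.map onˡ C) p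
        with wD , p ← All.++⁻ (List.map onᵐ D) p
        with z≤ , p ← All.++⁻ (List.tabulate z≤x) p
        with w≤ , ≤⊕ ← All.++⁻ (List.tabulate w≤x) p =
        All.map (λ {(i , b)} → subst₂ _⊑_ (cong embed (lookup-inˡ i)) (dotˡ b)) (All.map⁻ zC) ,
        All.map (λ {(i , b)} → subst₂ _⊑_ (cong embed (lookup-inᵐ i)) (dotᵐ b)) (All.map⁻ wD) ,
        lookup-ext (λ i → embed-injective (trans (⊑-antisym
          (subst₂ _⊑_ (cong embed (lookup-inʳ i)) (dotˡᵐ-unit i) (All.tabulate⁻ ≤⊕ i))
          (⊕-lub
            (subst₂ _⊑_ (cong embed (lookup-inˡ i)) (dotʳ-unit i) (All.tabulate⁻ z≤ i))
            (subst₂ _⊑_ (cong embed (lookup-inᵐ i)) (dotʳ-unit i) (All.tabulate⁻ w≤ i))))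
          (sym (embed-lookup-⊕ i))))

    -- Abstract, because unfolding the eliminations makes conversion checking blow up.
    abstract

      sum : System n → System n → System n
      sum C D = eliminateAll n (eliminateAll n (joint C D))

      sum-sound : ∀ z w C D → Solution z C → Solution w D → Solution (zipWith _⊕_ z w) (sum C D)
      sum-sound z w C D zC wD = eliminateAll-sound w x _
        (eliminateAll-sound z (w ++ x) (joint C D) (joint-sound z w x C D zC wD refl))
        where
        x : Point n
        x = zipWith _⊕_ z w

      sum-complete : ∀ x C D → Solution x (sum C D) →
                     ∃[ z ] ∃[ w ] Solution z C × Solution w D × x ≡ zipWith _⊕_ z w
      sum-complete x C D p
        with w , q ← eliminateAll-complete n x _ p
        with z , r ← eliminateAll-complete n (w ++ x) (joint C D) q =
        z , w , joint-complete z w x C D r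

  open Minkowski public using (sum; sum-sound; sum-complete)

  -- Cones over zones and their hull

  ≤⇔⊑ : ∀ {x y} → x ≤ y ⇔ embed x ⊑ embed y
  ≤⇔⊑ = mk⇔ embed-mono embed-cancel

  -- On Rmax, the strict order differs from `_≤ᴳ_` against 0⁻ ⊗ y only at x = y = -∞.
  <⇒⊑ : ∀ {x y} → x < y → embed x ⊑ 0# ⁻ ⊗ᴳ embed y × real 0# ⊑ +∞ ⊗ᴳ embed y
  <⇒⊑ AddInfimum.⊥₋<[ _ ] = ⊥-least , ⊤-greatest
  <⇒⊑ (AddInfimum.[_] {l = s} p) = ⊑⁺ R̄.[ subst (_ <ℝ_) (sym (+-identityˡ s)) p ] , ⊤-greatest

  ⊑⇒< : ∀ x y → embed x ⊑ 0# ⁻ ⊗ᴳ embed y → real 0# ⊑ +∞ ⊗ᴳ embed y → x < y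
  ⊑⇒< _         ⊥₋        _             q = contradiction q real⋢⊥
  ⊑⇒< ⊥₋        Inf.[ s ] _             _ = AddInfimum.⊥₋<[ s ]
  ⊑⇒< Inf.[ r ] Inf.[ s ] (⊑⁺ R̄.[ p ]) _ = AddInfimum.[ subst (r <ℝ_) (+-identityˡ s) p ]

  -- For a = -∞ the left side is -∞ and nothing is demanded; a finite a is divided out.
  bound : Rmax → Fin n → 𝔾 → Fin n → System n
  bound ⊥₋        i b j = []
  bound Inf.[ r ] i b j = (i , single j (real (- r) ⊗ᴳ b)) ∷ []

  solution-bound : ∀ a i b j (x : Point n) →
    Solution x (bound a i b j) ⇔ embed a ⊗ᴳ embed (lookup x i) ⊑ b ⊗ᴳ embed (lookup x j)
  solution-bound ⊥₋        i b j x = mk⇔ (λ _ → ⊥-least) (λ _ → [])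
  solution-bound Inf.[ r ] i b j x = mk⇔
    (λ { (p ∷ []) → x⊑-r⊗y⇒r⊗x⊑y r (subst (embed (lookup x i) ⊑_) eq p) })
    (λ p → subst (embed (lookup x i) ⊑_) (sym eq) (r⊗x⊑y⇒x⊑-r⊗y r p) ∷ [])
    where
    open ≡-Reasoning
    eq : dot (single j (real (- r) ⊗ᴳ b)) (map embed x) ≡ real (- r) ⊗ᴳ (b ⊗ᴳ embed (lookup x j))
    eq = begin
      dot (single j (real (- r) ⊗ᴳ b)) (map embed x)     ≡⟨ dot-single j (real (- r) ⊗ᴳ b) (map embed x) ⟩
      (real (- r) ⊗ᴳ b) ⊗ᴳ lookup (map embed x) j
        ≡⟨ cong ((real (- r) ⊗ᴳ b) ⊗ᴳ_) (lookup-map j embed x) ⟩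
      (real (- r) ⊗ᴳ b) ⊗ᴳ embed (lookup x j)            ≡⟨ ⊗-assoc (real (- r)) b (embed (lookup x j)) ⟩
      real (- r) ⊗ᴳ (b ⊗ᴳ embed (lookup x j))            ∎

  homogenize : Point n → Point (suc n)
  homogenize x = Inf.[ 0# ] ∷ x

  -- In the strict case `0# ⁻` alone would admit -∞ on both sides. The second inequality 𝐱₀ ≤ +∞ b
  -- 𝐱ⱼ excludes this at 𝐱₀ = 0; using 𝐱₀ for the constant 0 keeps the system homogeneous.
  comparison : Comparison → Rmax → Fin (suc n) → Rmax → Fin (suc n) → System (suc n)
  comparison nonstrict a i b j = bound a i (embed b) j
  comparison strict    a i b j =
    bound a i (0# ⁻ ⊗ᴳ embed b) j List.++ bound Inf.[ 0# ] zero (+∞ ⊗ᴳ embed b) j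

  solution-comparison : ∀ c a i b j (x : Point n) →
    Solution (homogenize x) (comparison c a i b j) ⇔
    (a ⊗ lookup (homogenize x) i) ⊲[ c ] (b ⊗ lookup (homogenize x) j)
  solution-comparison nonstrict a i b j x = mk⇔
    (λ p → embed-cancel (subst₂ _⊑_ (sym (embed-⊗ a (lookup y i))) (sym (embed-⊗ b (lookup y j)))
             (Equivalence.to (solution-bound a i (embed b) j y) p)))
    (λ p → Equivalence.from (solution-bound a i (embed b) j y)
             (subst₂ _⊑_ (embed-⊗ a (lookup y i)) (embed-⊗ b (lookup y j)) (embed-mono p)))
    where
    y : Point _
    y = homogenize x
  solution-comparison strict a i b j x = mk⇔
    (λ p → ⊑⇒< (a ⊗ lookup y i) (b ⊗ lookup y j)
      (subst₂ _⊑_ (sym (embed-⊗ a (lookup y i))) (assoc (0# ⁻)) (Equivalence.to below⇔ (All.++⁻ˡ below p)))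
      (subst₂ _⊑_ (⊗-identityˡ (real 0#)) (assoc +∞) (Equivalence.to positive⇔ (All.++⁻ʳ below p))))
    (λ p → All.++⁺
      (Equivalence.from below⇔
        (subst₂ _⊑_ (embed-⊗ a (lookup y i)) (sym (assoc (0# ⁻))) (proj₁ (<⇒⊑ p))))
      (Equivalence.from positive⇔
        (subst₂ _⊑_ (sym (⊗-identityˡ (real 0#))) (sym (assoc +∞)) (proj₂ (<⇒⊑ p)))))
    where
    y : Point _
    y = homogenize x
    below : System _
    below = bound a i (0# ⁻ ⊗ᴳ embed b) j
    below⇔ = solution-bound a i (0# ⁻ ⊗ᴳ embed b) j y
    positive⇔ = solution-bound Inf.[ 0# ] zero (+∞ ⊗ᴳ embed b) j y
    assoc : ∀ s → (s ⊗ᴳ embed b) ⊗ᴳ embed (lookup y j) ≡ s ⊗ᴳ embed (b ⊗ lookup y j)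
    assoc s = trans (⊗-assoc s (embed b) (embed (lookup y j)))
      (cong (s ⊗ᴳ_) (sym (embed-⊗ b (lookup y j))))

  ⊗ᴿ-identityˡ : ∀ x → Inf.[ 0# ] ⊗ x ≡ x
  ⊗ᴿ-identityˡ ⊥₋        = refl
  ⊗ᴿ-identityˡ Inf.[ x ] = cong Inf.[_] (+-identityˡ x)

  ⊗ᴿ-identityʳ : ∀ x → x ⊗ Inf.[ 0# ] ≡ x
  ⊗ᴿ-identityʳ ⊥₋        = refl
  ⊗ᴿ-identityʳ Inf.[ x ] = cong Inf.[_] (+-identityʳ x)

  zoneSystem : ZoneInequality n → System (suc n)
  zoneSystem (lower c m i)        = comparison c m zero Inf.[ 0# ] (suc i)
  zoneSystem (upper c i M)        = comparison c Inf.[ 0# ] (suc i) M zero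
  zoneSystem (difference c i k j) = comparison c Inf.[ 0# ] (suc i) k (suc j)

  solution-zoneSystem : ∀ (x : Point n) Z → Solution (homogenize x) (zoneSystem Z) ⇔ SatisfiesZone x Z
  solution-zoneSystem x (lower c m i) =
    subst₂ (λ s t → Solution (homogenize x) (zoneSystem (lower c m i)) ⇔ s ⊲[ c ] t)
      (⊗ᴿ-identityʳ m) (⊗ᴿ-identityˡ (lookup x i)) (solution-comparison c m zero Inf.[ 0# ] (suc i) x)
  solution-zoneSystem x (upper c i M) =
    subst₂ (λ s t → Solution (homogenize x) (zoneSystem (upper c i M)) ⇔ s ⊲[ c ] t)
      (⊗ᴿ-identityˡ (lookup x i)) (⊗ᴿ-identityʳ M) (solution-comparison c Inf.[ 0# ] (suc i) M zero x)
  solution-zoneSystem x (difference c i k j) =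
    subst (λ s → Solution (homogenize x) (zoneSystem (difference c i k j)) ⇔ s ⊲[ c ] (k ⊗ lookup x j))
      (⊗ᴿ-identityˡ (lookup x i)) (solution-comparison c Inf.[ 0# ] (suc i) k (suc j) x)

  -- The inequality 𝐱ᵢ ≤ +∞ 𝐱₀ forces 𝐱ᵢ = -∞ when 𝐱₀ = -∞ and is vacuous otherwise.
  dominated : Fin (suc n) → Inequality (suc n)
  dominated i = i , single zero +∞

  dot-dominated : ∀ t (x : Point n) → dot (single zero +∞) (map embed (t ∷ x)) ≡ +∞ ⊗ᴳ embed t
  dot-dominated t x = dot-single zero +∞ (map embed (t ∷ x))

  cone : List (ZoneInequality n) → System (suc n)
  cone Z = List.tabulate dominated List.++ List.concatMap zoneSystem Z

  solution-cone⁺ : ∀ (x : Point n) Z → All (SatisfiesZone x) Z → Solution (homogenize x) (cone Z)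
  solution-cone⁺ x Z p = All.++⁺
    (All.tabulate⁺ {f = dominated} λ i →
      subst (embed (lookup (homogenize x) i) ⊑_) (sym (dot-dominated Inf.[ 0# ] x)) ⊤-greatest)
    (All.concat⁺ (All.map⁺ (All.map (λ {z} → Equivalence.from (solution-zoneSystem x z)) p)))

  solution-cone⁻ : ∀ (x : Point n) Z → Solution (homogenize x) (cone Z) → All (SatisfiesZone x) Z
  solution-cone⁻ x Z p = All.map (λ {z} → Equivalence.to (solution-zoneSystem x z))
    (All.map⁻ (All.concat⁻ (All.++⁻ʳ (List.tabulate dominated) p)))

  ⊥s : Point n
  ⊥s = replicate _ ⊥₋

  ⊑⊥⇒≡⊥ : ∀ {x} → embed x ⊑ -∞ → x ≡ ⊥₋
  ⊑⊥⇒≡⊥ p = embed-injective (⊑-antisym p ⊥-least)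

  ⊑⊥⇒≡⊥s : ∀ (x : Point n) → (∀ i → embed (lookup x i) ⊑ -∞) → x ≡ ⊥s
  ⊑⊥⇒≡⊥s x p = lookup-ext λ i → trans (⊑⊥⇒≡⊥ (p i)) (sym (lookup-replicate i ⊥₋))

  -- The `dominated` inequalities exclude directions at infinity, that is, points with 𝐱₀ = -∞ and a
  -- finite coordinate, which the homogenised zone inequalities by themselves may admit.
  solution-cone-⊥ : ∀ (x : Point n) Z → Solution (⊥₋ ∷ x) (cone Z) → ⊥₋ ∷ x ≡ ⊥s
  solution-cone-⊥ x Z p = ⊑⊥⇒≡⊥s (⊥₋ ∷ x) λ i →
    subst (embed (lookup (⊥₋ ∷ x) i) ⊑_) (dot-dominated ⊥₋ x)
      (All.tabulate⁻ {f = dominated} (All.++⁻ˡ (List.tabulate dominated) p) i)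

  -- Homogeneity puts the zero vector into every solution set. In `solution-hull⁺` it serves as the
  -- trivial summand for all zones but one.
  ⊥s-solution : ∀ (S : System n) → Solution ⊥s S
  ⊥s-solution []            = []
  ⊥s-solution ((i , b) ∷ S) =
    subst (λ y → embed y ⊑ dot b (map embed ⊥s)) (sym (lookup-replicate i ⊥₋)) ⊥-least ∷ ⊥s-solution S

  zeroSystem : System n
  zeroSystem = List.tabulate (λ i → i , 𝟎)

  zeroSystem⇒⊥s : ∀ (x : Point n) → Solution x zeroSystem → x ≡ ⊥s
  zeroSystem⇒⊥s x p = ⊑⊥⇒≡⊥s x λ i →
    subst (embed (lookup x i) ⊑_) (dot-𝟎 (map embed x)) (All.tabulate⁻ {f = _, 𝟎} p i)

  map-embed-⊗ : ∀ a (x : Point n) → map embed (map (a ⊗_) x) ≡ map (embed a ⊗ᴳ_) (map embed x)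
  map-embed-⊗ a x = trans (sym (map-∘ embed (a ⊗_) x))
    (trans (map-cong (embed-⊗ a) x) (map-∘ (embed a ⊗ᴳ_) embed x))

  dot-scale : ∀ s (b v : Vec 𝔾 n) → dot b (map (s ⊗ᴳ_) v) ≡ s ⊗ᴳ dot b v
  dot-scale s b v = trans (dot-comm b (map (s ⊗ᴳ_) v))
    (trans (dot-map-⊗ s v b) (cong (s ⊗ᴳ_) (dot-comm v b)))

  scale-solution : ∀ a (x : Point n) S → Solution x S → Solution (map (a ⊗_) x) S
  scale-solution a x []            []       = []
  scale-solution a x ((i , b) ∷ S) (p ∷ ps) =
    subst₂ _⊑_
      (sym (trans (cong embed (lookup-map i (a ⊗_) x)) (embed-⊗ a (lookup x i))))
      (sym (trans (cong (dot b) (map-embed-⊗ a x)) (dot-scale (embed a) b (map embed x))))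
      (⊗-monoʳ (embed a) p)
    ∷ scale-solution a x S ps

  -- A sum of these cones is the cone generated by their union, so this describes the tropical
  -- convex hull of the zones in homogeneous coordinates. The zero cone is the neutral summand.
  hull : List (List (ZoneInequality n)) → System (suc n)
  hull = List.foldr (λ Z S → sum (cone Z) S) zeroSystem

  ⊕ᴿ-identityˡ : ∀ x → ⊥₋ ⊕ x ≡ x
  ⊕ᴿ-identityˡ x = embed-injective (trans (embed-⊕ ⊥₋ x) (⊕-identityˡ (embed x)))

  ⊕ᴿ-identityʳ : ∀ x → x ⊕ ⊥₋ ≡ x
  ⊕ᴿ-identityʳ x = embed-injective (trans (embed-⊕ x ⊥₋) (⊕-identityʳ (embed x)))

  ⊕s-identityˡ : ∀ (x : Point n) → zipWith _⊕_ ⊥s x ≡ x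
  ⊕s-identityˡ = zipWith-identityˡ ⊕ᴿ-identityˡ

  ⊕s-identityʳ : ∀ (x : Point n) → zipWith _⊕_ x ⊥s ≡ x
  ⊕s-identityʳ = zipWith-identityʳ ⊕ᴿ-identityʳ

  solution-hull⁺ : ∀ (x : Point n) Zs → Any (All (SatisfiesZone x)) Zs →
                   Solution (homogenize x) (hull Zs)
  solution-hull⁺ x (Z ∷ Zs) (here p)  =
    subst (λ y → Solution y (hull (Z ∷ Zs))) (⊕s-identityʳ (homogenize x))
    (sum-sound (homogenize x) ⊥s (cone Z) (hull Zs) (solution-cone⁺ x Z p) (⊥s-solution (hull Zs)))
  solution-hull⁺ x (Z ∷ Zs) (there p) =
    subst (λ y → Solution y (hull (Z ∷ Zs))) (⊕s-identityˡ (homogenize x))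
    (sum-sound ⊥s (homogenize x) (cone Z) (hull Zs) (⊥s-solution (cone Z)) (solution-hull⁺ x Zs p))

  -- Dividing by the second weight leaves the weights r - s and 0. For r ≤ s their maximum is 0, as
  -- a convex combination requires.
  rescale : ∀ r s a b → (Inf.[ r ] ⊗ a) ⊕ (Inf.[ s ] ⊗ b) ≡
                        Inf.[ s ] ⊗ ((Inf.[ r + - s ] ⊗ a) ⊕ (Inf.[ 0# ] ⊗ b))
  rescale r s a b = embed-injective (begin
    embed ((Inf.[ r ] ⊗ a) ⊕ (Inf.[ s ] ⊗ b))
      ≡⟨ embed-⊕ (Inf.[ r ] ⊗ a) (Inf.[ s ] ⊗ b) ⟩
    embed (Inf.[ r ] ⊗ a) ⊕ᴳ embed (Inf.[ s ] ⊗ b)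
      ≡⟨ cong₂ _⊕ᴳ_ (trans (embed-⊗ Inf.[ r ] a) split)
           (trans (embed-⊗ Inf.[ s ] b) (cong (λ t → real s ⊗ᴳ embed t) (sym (⊗ᴿ-identityˡ b)))) ⟩
    real s ⊗ᴳ embed (Inf.[ r + - s ] ⊗ a) ⊕ᴳ real s ⊗ᴳ embed (Inf.[ 0# ] ⊗ b)
      ≡⟨ ⊗-distribˡ (real s) (embed (Inf.[ r + - s ] ⊗ a)) (embed (Inf.[ 0# ] ⊗ b)) ⟨
    real s ⊗ᴳ (embed (Inf.[ r + - s ] ⊗ a) ⊕ᴳ embed (Inf.[ 0# ] ⊗ b))
      ≡⟨ cong (real s ⊗ᴳ_) (embed-⊕ (Inf.[ r + - s ] ⊗ a) (Inf.[ 0# ] ⊗ b)) ⟨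
    real s ⊗ᴳ embed ((Inf.[ r + - s ] ⊗ a) ⊕ (Inf.[ 0# ] ⊗ b))
      ≡⟨ embed-⊗ Inf.[ s ] ((Inf.[ r + - s ] ⊗ a) ⊕ (Inf.[ 0# ] ⊗ b)) ⟨
    embed (Inf.[ s ] ⊗ ((Inf.[ r + - s ] ⊗ a) ⊕ (Inf.[ 0# ] ⊗ b))) ∎)
    where
    open ≡-Reasoning
    split : real r ⊗ᴳ embed a ≡ real s ⊗ᴳ embed (Inf.[ r + - s ] ⊗ a)
    split = begin
      real r ⊗ᴳ embed a                       ≡⟨ cong (λ t → real t ⊗ᴳ embed a) (x+[y-x]≡y s r) ⟨
      (real s ⊗ᴳ real (r + - s)) ⊗ᴳ embed a   ≡⟨ ⊗-assoc (real s) (real (r + - s)) (embed a) ⟩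
      real s ⊗ᴳ (real (r + - s) ⊗ᴳ embed a)   ≡⟨ cong (real s ⊗ᴳ_) (embed-⊗ Inf.[ r + - s ] a) ⟨
      real s ⊗ᴳ embed (Inf.[ r + - s ] ⊗ a)   ∎

  combine : Rmax → Point m → Rmax → Point m → Point m
  combine a x b y = zipWith _⊕_ (map (a ⊗_) x) (map (b ⊗_) y)

  combine-rescale : ∀ r s (x y : Point m) →
    combine Inf.[ r ] x Inf.[ s ] y ≡ map (Inf.[ s ] ⊗_) (combine Inf.[ r + - s ] x Inf.[ 0# ] y)
  combine-rescale r s []       []       = refl
  combine-rescale r s (a ∷ x) (b ∷ y) = cong₂ _∷_ (rescale r s a b) (combine-rescale r s x y)

  -- The normalisation a ⊕ b = 0 is what keeps the coordinate 𝐱₀ at 0.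
  homogenize-combine : ∀ a b (x y : Point m) → a ⊕ b ≡ Inf.[ 0# ] →
                       combine a (homogenize x) b (homogenize y) ≡ homogenize (combine a x b y)
  homogenize-combine a b x y a⊕b≡0 = cong (_∷ combine a x b y)
    (trans (cong₂ _⊕_ (⊗ᴿ-identityʳ a) (⊗ᴿ-identityʳ b)) a⊕b≡0)

  -- The hull of the zones of a convex set.

  module _ {ℓ} (P : Pred (Point n) ℓ) (convex : IsTropicallyConvex P) where

    -- The zero vector is a separate alternative: it must be present even when P is empty, and the
    -- scalar in the other alternative is then real, hence invertible.
    ConeOver : Pred (Point (suc n)) ℓ
    ConeOver w = w ≡ ⊥s ⊎ ∃[ r ] ∃[ y ] y ∈ P × w ≡ map (Inf.[ r ] ⊗_) (homogenize y)

    [r-s]⊕0≡0 : ∀ {r s} → r ≤ℝ s → Inf.[ r + - s ] ⊕ Inf.[ 0# ] ≡ Inf.[ 0# ]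
    [r-s]⊕0≡0 {r} {s} r≤s = embed-injective (trans (embed-⊕ Inf.[ r + - s ] Inf.[ 0# ])
      (x⊑y⇒x⊕y≡y {real (r + - s)} {real 0#}
        (⊑⁺ (≤̄⁺ (subst (r + - s ≤ℝ_) (-‿inverseʳ s) (+-monoˡ-≤ (- s) r≤s))))))

    ConeOver-combine : ∀ {r s y z} → r ≤ℝ s → y ∈ P → z ∈ P →
                       ConeOver (combine Inf.[ r ] (homogenize y) Inf.[ s ] (homogenize z))
    ConeOver-combine {r} {s} {y} {z} r≤s y∈P z∈P =
      inj₂ (s , combine Inf.[ r + - s ] y Inf.[ 0# ] z ,
            convex Inf.[ r + - s ] Inf.[ 0# ] y∈P z∈P ([r-s]⊕0≡0 r≤s) ,
            trans (combine-rescale r s (homogenize y) (homogenize z))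
              (cong (map (Inf.[ s ] ⊗_))
                (homogenize-combine Inf.[ r + - s ] Inf.[ 0# ] y z ([r-s]⊕0≡0 r≤s))))

    ConeOver-⊕ : ∀ w w′ → ConeOver w → ConeOver w′ → ConeOver (zipWith _⊕_ w w′)
    ConeOver-⊕ w w′ (inj₁ refl) c′ = subst ConeOver (sym (⊕s-identityˡ w′)) c′
    ConeOver-⊕ w w′ c (inj₁ refl)  = subst ConeOver (sym (⊕s-identityʳ w)) c
    ConeOver-⊕ w w′ (inj₂ (r , y , y∈P , refl)) (inj₂ (s , z , z∈P , refl)) with compare r s
    ... | tri< r<s _ _ = ConeOver-combine (inj₁ r<s) y∈P z∈P
    ... | tri≈ _ r≡s _ = ConeOver-combine (inj₂ r≡s) y∈P z∈P
    -- `ConeOver-combine` wants the larger weight second, so the summands are exchanged.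
    ... | tri> _ _ s<r = subst ConeOver
      (zipWith-comm Maxᴿ.⊔-comm (map (Inf.[ s ] ⊗_) (homogenize z)) (map (Inf.[ r ] ⊗_) (homogenize y)))
      (ConeOver-combine (inj₁ s<r) z∈P y∈P)

    cone⊆ConeOver : ∀ Z → (∀ x → All (SatisfiesZone x) Z → x ∈ P) →
                    ∀ w → Solution w (cone Z) → ConeOver w
    cone⊆ConeOver Z Z⊆P (⊥₋        ∷ w) p = inj₁ (solution-cone-⊥ w Z p)
    cone⊆ConeOver Z Z⊆P (Inf.[ r ] ∷ w) p =
      inj₂ (r , y , Z⊆P y (solution-cone⁻ y Z solution-y) , cong₂ _∷_ (cong Inf.[_] (sym (+-identityʳ r))) w≡)
      where
      -- Division by the finite coordinate 𝐱₀ = r moves the point to the section 𝐱₀ = 0.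
      y : Point n
      y = map (Inf.[ - r ] ⊗_) w
      cancel : ∀ t → Inf.[ r ] ⊗ (Inf.[ - r ] ⊗ t) ≡ t
      cancel ⊥₋        = refl
      cancel Inf.[ t ] = cong Inf.[_] (x+[-x+y]≡y r t)
      w≡ : w ≡ map (Inf.[ r ] ⊗_) y
      w≡ = sym (trans (sym (map-∘ (Inf.[ r ] ⊗_) (Inf.[ - r ] ⊗_) w)) (trans (map-cong cancel w) (map-id w)))
      solution-y : Solution (homogenize y) (cone Z)
      solution-y = subst (λ t → Solution (Inf.[ t ] ∷ y) (cone Z)) (-‿inverseˡ r)
        (scale-solution Inf.[ - r ] (Inf.[ r ] ∷ w) (cone Z) p)

    -- Convexity enters here: through `ConeOver-⊕` it makes the cone over P closed under sums, so
    -- summing the cones over the zones does not lead out of it.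
    hull⊆ConeOver : ∀ Zs → (∀ x → Any (All (SatisfiesZone x)) Zs → x ∈ P) →
                    ∀ w → Solution w (hull Zs) → ConeOver w
    hull⊆ConeOver []       _     w p = inj₁ (zeroSystem⇒⊥s w p)
    hull⊆ConeOver (Z ∷ Zs) Zs⊆P w p
      with z , z′ , z∈ , z′∈ , refl ← sum-complete w (cone Z) (hull Zs) p =
      ConeOver-⊕ z z′ (cone⊆ConeOver Z (λ x → Zs⊆P x ∘ here) z z∈)
                      (hull⊆ConeOver Zs (λ x → Zs⊆P x ∘ there) z′ z′∈)

    -- Comparing the coordinate 𝐱₀ on both sides forces the scalar to be 0.
    ConeOver⇒∈ : ∀ x → ConeOver (homogenize x) → x ∈ P
    ConeOver⇒∈ x (inj₁ ())
    ConeOver⇒∈ x (inj₂ (r , y , y∈P , eq)) = subst (_∈ P) (sym x≡y) y∈P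
      where
      open ≡-Reasoning
      r≡0 : r ≡ 0#
      r≡0 = trans (sym (+-identityʳ r)) (sym (Inf.[]-injective (∷-injectiveˡ eq)))
      x≡y : x ≡ y
      x≡y = begin
        x                          ≡⟨ ∷-injectiveʳ eq ⟩
        map (Inf.[ r ] ⊗_) y       ≡⟨ cong (λ t → map (Inf.[ t ] ⊗_) y) r≡0 ⟩
        map (Inf.[ 0# ] ⊗_) y      ≡⟨ map-cong ⊗ᴿ-identityˡ y ⟩
        map id y                   ≡⟨ map-id y ⟩
        y                          ∎

  -- From homogeneous inequalities back to mixed ones.

  affine≡dot : ∀ (b : Vec 𝔾 (suc n)) x → affine (head b) (tail b) x ≡ dot b (map embed (homogenize x))
  affine≡dot (b₀ ∷ b) x = cong (_⊕ᴳ dot b (map embed x)) (sym (⊗-identityʳ b₀))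

  unitᴿ : Fin n → Point n
  unitᴿ i = ⊥s [ i ]≔ Inf.[ 0# ]

  dot-unitᴿ : ∀ i (v : Vec 𝔾 n) → dot (map embed (unitᴿ i)) v ≡ lookup v i
  dot-unitᴿ {n} i v = begin
    dot (map embed (unitᴿ i)) v        ≡⟨ cong (λ b → dot b v) (map-[]≔ embed ⊥s i) ⟩
    dot (map embed ⊥s [ i ]≔ real 0#) v ≡⟨ cong (λ b → dot (b [ i ]≔ real 0#) v) (map-replicate embed ⊥₋ n) ⟩
    dot (single i (real 0#)) v         ≡⟨ dot-single i (real 0#) v ⟩
    real 0# ⊗ᴳ lookup v i              ≡⟨ ⊗-identityˡ (lookup v i) ⟩
    lookup v i                         ∎
    where open ≡-Reasoning

  toMixed : Inequality (suc n) → MixedInequality n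
  toMixed (i , b) = record { a₀ = head (unitᴿ i) ; a = tail (unitᴿ i) ; b₀ = head b ; b = tail b }

  affine-embed≡dot : ∀ (a : Point (suc n)) x →
    affine (embed (head a)) (map embed (tail a)) x ≡ dot (map embed a) (map embed (homogenize x))
  affine-embed≡dot (a₀ ∷ a) = affine≡dot (embed a₀ ∷ map embed a)

  satisfies-toMixed : ∀ (x : Point n) I → Satisfies x (toMixed I) ⇔ homogenize x ⊨ I
  satisfies-toMixed x (i , b) = mk⇔
    (λ p → subst₂ _⊑_ lhs rhs (⊑⁺ p))
    (λ p → ⊑⁻ (subst₂ _⊑_ (sym lhs) (sym rhs) p))
    where
    lhs : affine (embed (head (unitᴿ i))) (map embed (tail (unitᴿ i))) x ≡ embed (lookup (homogenize x) i)
    lhs = trans (affine-embed≡dot (unitᴿ i) x)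
      (trans (dot-unitᴿ i (map embed (homogenize x))) (lookup-map i embed (homogenize x)))
    rhs : affine (head b) (tail b) x ≡ dot b (map embed (homogenize x))
    rhs = affine≡dot b x

  zones⇒mixed : ∀ {ℓ} (P : Pred (Point n) ℓ) → IsTropicallyConvex P →
    ∀ Zs → (∀ x → x ∈ P ⇔ Any (All (SatisfiesZone x)) Zs) → IsMixedPolyhedron P
  zones⇒mixed P convex Zs P⇔Zs = List.map toMixed (hull Zs) ,
    (λ {x} x∈P → All.map⁺ (All.map (λ {I} → Equivalence.from (satisfies-toMixed x I))
      (solution-hull⁺ x Zs (Equivalence.to (P⇔Zs x) x∈P)))) ,
    (λ {x} p → ConeOver⇒∈ P convex x (hull⊆ConeOver P convex Zs (λ y → Equivalence.from (P⇔Zs y))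
      (homogenize x) (All.map (λ {I} → Equivalence.to (satisfies-toMixed x I)) (All.map⁻ p))))

  -- `IsFiniteUnionOfZones` presents the zones as predicates; only their inequalities matter.
  zoneLists : ∀ {Zs : List (Pred (Point n) 0ℓ)} → All IsZone Zs →
              ∃[ Ls ] (∀ x → Any (x ∈_) Zs ⇔ Any (All (SatisfiesZone x)) Ls)
  zoneLists [] = [] , λ x → mk⇔ (λ ()) (λ ())
  zoneLists ((L , Z⊆L , L⊆Z) ∷ zs) with Ls , Zs⇔Ls ← zoneLists zs = L ∷ Ls , λ x → mk⇔
    (λ { (here p) → here (Z⊆L p) ; (there q) → there (Equivalence.to (Zs⇔Ls x) q) })
    (λ { (here p) → here (L⊆Z p) ; (there q) → there (Equivalence.from (Zs⇔Ls x) q) })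

  convex∧zones⇒mixed : ∀ {ℓ} (P : Pred (Point n) ℓ) →
                       IsTropicallyConvex P × IsFiniteUnionOfZones P → IsMixedPolyhedron P
  convex∧zones⇒mixed P (convex , Zs , zones , P⊆Zs , Zs⊆P) with Ls , Zs⇔Ls ← zoneLists zones =
    zones⇒mixed P convex Ls λ x → mk⇔
      (λ p → Equivalence.to (Zs⇔Ls x) (P⊆Zs p)) (λ q → Zs⊆P (Equivalence.from (Zs⇔Ls x) q))

  -- Solution sets of mixed inequalities as unions of zones

  dot-⊕ʳ : ∀ (b v w : Vec 𝔾 n) → dot b (zipWith _⊕ᴳ_ v w) ≡ dot b v ⊕ᴳ dot b w
  dot-⊕ʳ b v w = trans (dot-comm b (zipWith _⊕ᴳ_ v w))
    (trans (dot-zipWith-⊕ v w b) (cong₂ _⊕ᴳ_ (dot-comm v b) (dot-comm w b)))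

  map-embed-⊕ : ∀ (x y : Point n) → map embed (zipWith _⊕_ x y) ≡
                                     zipWith _⊕ᴳ_ (map embed x) (map embed y)
  map-embed-⊕ []      []       = refl
  map-embed-⊕ (a ∷ x) (b ∷ y) = cong₂ _∷_ (embed-⊕ a b) (map-embed-⊕ x y)

  dot-combine : ∀ (b : Vec 𝔾 n) s t (x y : Point n) →
    dot b (map embed (combine s x t y)) ≡
    embed s ⊗ᴳ dot b (map embed x) ⊕ᴳ embed t ⊗ᴳ dot b (map embed y)
  dot-combine b s t x y = begin
    dot b (map embed (combine s x t y))
      ≡⟨ cong (dot b) (map-embed-⊕ (map (s ⊗_) x) (map (t ⊗_) y)) ⟩
    dot b (zipWith _⊕ᴳ_ (map embed (map (s ⊗_) x)) (map embed (map (t ⊗_) y)))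
      ≡⟨ dot-⊕ʳ b (map embed (map (s ⊗_) x)) (map embed (map (t ⊗_) y)) ⟩
    dot b (map embed (map (s ⊗_) x)) ⊕ᴳ dot b (map embed (map (t ⊗_) y))
      ≡⟨ cong₂ _⊕ᴳ_ (scaled s x) (scaled t y) ⟩
    embed s ⊗ᴳ dot b (map embed x) ⊕ᴳ embed t ⊗ᴳ dot b (map embed y) ∎
    where
    open ≡-Reasoning
    scaled : ∀ a z → dot b (map embed (map (a ⊗_) z)) ≡ embed a ⊗ᴳ dot b (map embed z)
    scaled a z = trans (cong (dot b) (map-embed-⊗ a z)) (dot-scale (embed a) b (map embed z))

  module _ (I : MixedInequality n) where
    open MixedInequality I

    lhs : Vec Rmax (suc n)
    lhs = a₀ ∷ a

    rhs : Vec 𝔾 (suc n)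
    rhs = b₀ ∷ b

    satisfies⇔dot⊑dot : ∀ x → Satisfies x I ⇔
      dot (map embed lhs) (map embed (homogenize x)) ⊑ dot rhs (map embed (homogenize x))
    satisfies⇔dot⊑dot x = mk⇔
      (λ p → subst₂ _⊑_ (affine-embed≡dot lhs x) (affine≡dot rhs x) (⊑⁺ p))
      (λ p → ⊑⁻ (subst₂ _⊑_ (sym (affine-embed≡dot lhs x)) (sym (affine≡dot rhs x)) p))

    satisfies-convex : IsTropicallyConvex (λ x → Satisfies x I)
    satisfies-convex {x} {y} s t p q s⊕t≡0 = Equivalence.from (satisfies⇔dot⊑dot (combine s x t y))
      (subst₂ _⊑_ (sym (dot-hom (map embed lhs))) (sym (dot-hom rhs))
        (⊕-mono (⊗-monoʳ (embed s) (Equivalence.to (satisfies⇔dot⊑dot x) p))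
                (⊗-monoʳ (embed t) (Equivalence.to (satisfies⇔dot⊑dot y) q))))
      where
      dot-hom : ∀ c → dot c (map embed (homogenize (combine s x t y))) ≡
        embed s ⊗ᴳ dot c (map embed (homogenize x)) ⊕ᴳ embed t ⊗ᴳ dot c (map embed (homogenize y))
      dot-hom c = trans (cong (dot c ∘ map embed) (sym (homogenize-combine s t x y s⊕t≡0)))
        (dot-combine c s t (homogenize x) (homogenize y))

  -- Finite unions of zones and their closure under set operations.

  record ZoneUnion (P : Pred (Point n) 0ℓ) : Set where
    field
      zones : List (List (ZoneInequality n))
      spec  : ∀ x → x ∈ P ⇔ Any (All (SatisfiesZone x)) zones
  open ZoneUnion

  private variable
    P Q : Pred (Point n) 0ℓ

  ZoneUnion-resp : (∀ x → x ∈ P ⇔ x ∈ Q) → ZoneUnion P → ZoneUnion Q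
  ZoneUnion-resp P⇔Q U = record { zones = zones U ; spec = λ x → mk⇔
    (λ q → Equivalence.to (spec U x) (Equivalence.from (P⇔Q x) q))
    (λ p → Equivalence.to (P⇔Q x) (Equivalence.from (spec U x) p)) }

  ZoneUnion-zone : ∀ Z → ZoneUnion {n} (λ x → SatisfiesZone x Z)
  ZoneUnion-zone Z = record { zones = (Z ∷ []) ∷ [] ; spec = λ x → mk⇔
    (λ p → here (p ∷ [])) (λ { (here (p ∷ [])) → p ; (there ()) }) }

  ZoneUnion-∅ : (∀ x → ¬ x ∈ P) → ZoneUnion {n} P
  ZoneUnion-∅ ¬P = record { zones = [] ; spec = λ x → mk⇔ (λ p → contradiction p (¬P x)) (λ ()) }

  ZoneUnion-U : (∀ x → x ∈ P) → ZoneUnion {n} P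
  ZoneUnion-U p = record { zones = [] ∷ [] ; spec = λ x → mk⇔ (λ _ → here []) (λ _ → p x) }

  ZoneUnion-∪ : ZoneUnion P → ZoneUnion Q → ZoneUnion {n} (P ∪ Q)
  ZoneUnion-∪ U V = record { zones = zones U List.++ zones V ; spec = λ x → mk⇔
    (λ { (inj₁ p) → Any.++⁺ˡ (Equivalence.to (spec U x) p)
       ; (inj₂ q) → Any.++⁺ʳ (zones U) (Equivalence.to (spec V x) q) })
    (λ r → Sum.map (Equivalence.from (spec U x)) (Equivalence.from (spec V x)) (Any.++⁻ (zones U) r)) }

  -- Intersection distributes over union: each pair of zones contributes the zone cut out by the
  -- inequalities of both.
  ZoneUnion-∩ : ZoneUnion P → ZoneUnion Q → ZoneUnion {n} (P ∩ Q)
  ZoneUnion-∩ U V = record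
    { zones = List.cartesianProductWith List._++_ (zones U) (zones V)
    ; spec  = λ x → mk⇔
      (λ { (p , q) → Any.cartesianProductWith⁺ List._++_ All.++⁺
                       (Equivalence.to (spec U x) p) (Equivalence.to (spec V x) q) })
      (λ r → let p , q = Any.cartesianProductWith⁻ List._++_ (λ {ys} → All.++⁻ ys) (zones U) (zones V) r in
             Equivalence.from (spec U x) p , Equivalence.from (spec V x) q) }

  ZoneUnion-∃ : ∀ {m} {P : Fin m → Pred (Point n) 0ℓ} → (∀ i → ZoneUnion (P i)) →
                ZoneUnion (λ x → ∃[ i ] x ∈ P i)
  ZoneUnion-∃ {m = zero}  U = ZoneUnion-∅ λ { _ (() , _) }
  ZoneUnion-∃ {m = suc m} U = ZoneUnion-resp
    (λ x → mk⇔ (λ { (inj₁ p) → zero , p ; (inj₂ (i , p)) → suc i , p })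
               (λ { (zero , p) → inj₁ p ; (suc i , p) → inj₂ (i , p) }))
    (ZoneUnion-∪ (U zero) (ZoneUnion-∃ (U ∘ suc)))

  ZoneUnion-∀ : ∀ {m} {P : Fin m → Pred (Point n) 0ℓ} → (∀ i → ZoneUnion (P i)) →
                ZoneUnion (λ x → ∀ i → x ∈ P i)
  ZoneUnion-∀ {m = zero}  U = ZoneUnion-U λ { _ () }
  ZoneUnion-∀ {m = suc m} U = ZoneUnion-resp
    (λ x → mk⇔ (λ { (p , ps) zero → p ; (p , ps) (suc i) → ps i }) (λ p → p zero , p ∘ suc))
    (ZoneUnion-∩ (U zero) (ZoneUnion-∀ (U ∘ suc)))

  ZoneUnion-All : ∀ {A : Set} {P : A → Pred (Point n) 0ℓ} → (∀ a → ZoneUnion (P a)) →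
                  ∀ as → ZoneUnion (λ x → All (λ a → x ∈ P a) as)
  ZoneUnion-All U []       = ZoneUnion-U λ _ → []
  ZoneUnion-All U (a ∷ as) = ZoneUnion-resp
    (λ x → mk⇔ (λ { (p , ps) → p ∷ ps }) (λ { (p ∷ ps) → p , ps }))
    (ZoneUnion-∩ (U a) (ZoneUnion-All U as))

  -- Zones for single terms, and for whole inequalities.

  private
    coordinate : Fin (suc n) → Point n → Rmax
    coordinate i x = lookup (homogenize x) i

    hom : Point n → Vec 𝔾 (suc n)
    hom x = map embed (homogenize x)

    lookup-hom : ∀ (x : Point n) i → lookup (hom x) i ≡ embed (coordinate i x)
    lookup-hom x i = lookup-map i embed (homogenize x)

  ≤⊥⇔≡⊥ : ∀ x → x ≤ ⊥₋ ⇔ x ≡ ⊥₋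
  ≤⊥⇔≡⊥ x = mk⇔ (λ { (inj₁ ()) ; (inj₂ eq) → eq }) inj₂

  ZoneUnion-≡⊥ : ∀ i → ZoneUnion {n} (λ x → coordinate i x ≡ ⊥₋)
  ZoneUnion-≡⊥ zero    = ZoneUnion-∅ λ _ ()
  ZoneUnion-≡⊥ (suc i) = ZoneUnion-resp (λ x → ≤⊥⇔≡⊥ (lookup x i)) (ZoneUnion-zone (upper nonstrict i ⊥₋))

  ZoneUnion-⊥< : ∀ i → ZoneUnion {n} (λ x → ⊥₋ < coordinate i x)
  ZoneUnion-⊥< zero    = ZoneUnion-U λ _ → AddInfimum.⊥₋<[ 0# ]
  ZoneUnion-⊥< (suc i) = ZoneUnion-zone (lower strict ⊥₋ i)

  _⊲?_ : ∀ {c} x y → Dec (x ⊲[ c ] y)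
  _⊲?_ {nonstrict} x y = StrictTotalOrderProperties._≤?_ Rmax-strictTotalOrder x y
  _⊲?_ {strict}    x y = StrictTotalOrder._<?_ Rmax-strictTotalOrder x y

  translate-< : ∀ r {x y} → x < y → Inf.[ r ] ⊗ x < Inf.[ r ] ⊗ y
  translate-< r AddInfimum.⊥₋<[ _ ] = AddInfimum.⊥₋<[ _ ]
  translate-< r AddInfimum.[ p ]    = AddInfimum.[ +-monoʳ-< r p ]

  translate : ∀ c r {x y} → x ⊲[ c ] y → (Inf.[ r ] ⊗ x) ⊲[ c ] (Inf.[ r ] ⊗ y)
  translate strict    r p           = translate-< r p
  translate nonstrict r (inj₁ p)    = inj₁ (translate-< r p)
  translate nonstrict r (inj₂ refl) = inj₂ refl

  -r⊗ᴿ[r⊗x]≡x : ∀ r x → Inf.[ - r ] ⊗ (Inf.[ r ] ⊗ x) ≡ x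
  -r⊗ᴿ[r⊗x]≡x r ⊥₋        = refl
  -r⊗ᴿ[r⊗x]≡x r Inf.[ x ] = cong Inf.[_] (-x+[x+y]≡y r x)

  -- Since 𝐱₀ = 0, the four cases are a decidable statement about constants, a lower bound, an upper
  -- bound and a difference bound.
  ZoneUnion-⊲ : ∀ c i r j → ZoneUnion {n} (λ x → coordinate i x ⊲[ c ] (Inf.[ r ] ⊗ coordinate j x))
  ZoneUnion-⊲ c zero r zero with _⊲?_ {c} Inf.[ 0# ] Inf.[ r + 0# ]
  ... | yes p = ZoneUnion-U λ _ → p
  ... | no ¬p = ZoneUnion-∅ λ _ → ¬p
  ZoneUnion-⊲ c zero    r (suc j) = ZoneUnion-resp
    (λ x → mk⇔
      (λ p → subst (_⊲[ c ] (Inf.[ r ] ⊗ lookup x j)) (cong Inf.[_] (-‿inverseʳ r)) (translate c r p))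
      (λ p → subst₂ _⊲[ c ]_ (⊗ᴿ-identityʳ Inf.[ - r ]) (-r⊗ᴿ[r⊗x]≡x r (lookup x j)) (translate c (- r) p)))
    (ZoneUnion-zone (lower c Inf.[ - r ] j))
  ZoneUnion-⊲ c (suc i) r zero    = subst (λ s → ZoneUnion (λ x → lookup x i ⊲[ c ] s))
    (sym (⊗ᴿ-identityʳ Inf.[ r ])) (ZoneUnion-zone (upper c i Inf.[ r ]))
  ZoneUnion-⊲ c (suc i) r (suc j) = ZoneUnion-zone (difference c i Inf.[ r ] j)

  -- The alternative x = -∞ covers x = y = -∞, where the strict inequality fails; because of it a
  -- single term becomes a union of two zones.
  ⊑⁻⇔ : ∀ x r y → (x ≡ ⊥₋ ⊎ x < Inf.[ r ] ⊗ y) ⇔ embed x ⊑ r ⁻ ⊗ᴳ embed y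
  ⊑⁻⇔ ⊥₋        r y         = mk⇔ (λ _ → ⊥-least) (λ _ → inj₁ refl)
  ⊑⁻⇔ Inf.[ x ] r ⊥₋        = mk⇔ (λ { (inj₂ ()) }) (λ p → contradiction p real⋢⊥)
  ⊑⁻⇔ Inf.[ x ] r Inf.[ y ] = mk⇔ (λ { (inj₂ AddInfimum.[ p ]) → ⊑⁺ R̄.[ p ] })
                                   (λ { (⊑⁺ R̄.[ p ]) → inj₂ AddInfimum.[ p ] })

  -- The product of +∞ and y is +∞ or -∞ and records only whether y is finite.
  ⊑⊤⇔ : ∀ x y → (x ≡ ⊥₋ ⊎ ⊥₋ < y) ⇔ embed x ⊑ +∞ ⊗ᴳ embed y
  ⊑⊤⇔ ⊥₋        y         = mk⇔ (λ _ → ⊥-least) (λ _ → inj₁ refl)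
  ⊑⊤⇔ Inf.[ x ] ⊥₋        = mk⇔ (λ { (inj₂ ()) }) (λ p → contradiction p real⋢⊥)
  ⊑⊤⇔ Inf.[ x ] Inf.[ y ] = mk⇔ (λ _ → ⊤-greatest) (λ _ → inj₂ AddInfimum.⊥₋<[ y ])

  ⊑⊥⇔ : ∀ x → x ≡ ⊥₋ ⇔ embed x ⊑ -∞
  ⊑⊥⇔ x = mk⇔ (⊑-reflexive ∘ cong embed) ⊑⊥⇒≡⊥

  ZoneUnion-term : ∀ i b j → ZoneUnion {n} (λ x → embed (coordinate i x) ⊑ b ⊗ᴳ embed (coordinate j x))
  ZoneUnion-term i -∞       j = ZoneUnion-resp (λ x → ⊑⊥⇔ (coordinate i x)) (ZoneUnion-≡⊥ i)
  ZoneUnion-term i (real r) j = ZoneUnion-resp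
    (λ x → subst (λ y → coordinate i x ≤ Inf.[ r ] ⊗ coordinate j x ⇔ embed (coordinate i x) ⊑ y)
      (embed-⊗ Inf.[ r ] (coordinate j x)) ≤⇔⊑)
    (ZoneUnion-⊲ nonstrict i r j)
  ZoneUnion-term i +∞       j = ZoneUnion-resp (λ x → ⊑⊤⇔ (coordinate i x) (coordinate j x))
    (ZoneUnion-∪ (ZoneUnion-≡⊥ i) (ZoneUnion-⊥< j))
  ZoneUnion-term i (r ⁻)    j = ZoneUnion-resp (λ x → ⊑⁻⇔ (coordinate i x) r (coordinate j x))
    (ZoneUnion-∪ (ZoneUnion-≡⊥ i) (ZoneUnion-⊲ strict i r j))

  ZoneUnion-⊨ : ∀ (I : Inequality (suc n)) → ZoneUnion (λ x → homogenize x ⊨ I)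
  ZoneUnion-⊨ (i , b) = ZoneUnion-resp
    (λ x → mk⇔
      (λ { (inj₁ p)       → ⊑-trans p ⊥-least
         ; (inj₂ (j , p)) → ⊑-trans p (subst (λ y → lookup b j ⊗ᴳ y ⊑ dot b (hom x)) (lookup-hom x j)
                              (term⊑dot b (hom x) j)) })
      (λ p → Sum.map₂
        (λ { (j , q) → j , subst (λ y → embed (coordinate i x) ⊑ lookup b j ⊗ᴳ y) (lookup-hom x j) q })
        (dot-attained b (hom x) p)))
    (ZoneUnion-∪ (ZoneUnion-resp (λ x → ⊑⊥⇔ (coordinate i x)) (ZoneUnion-≡⊥ i))
                 (ZoneUnion-∃ λ j → ZoneUnion-term i (lookup b j) j))

  ZoneUnion-scaled : ∀ a i (b : Vec 𝔾 (suc n)) →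
    ZoneUnion (λ x → embed a ⊗ᴳ embed (coordinate i x) ⊑ dot b (hom x))
  ZoneUnion-scaled ⊥₋        i b = ZoneUnion-U λ _ → ⊥-least
  ZoneUnion-scaled Inf.[ r ] i b = ZoneUnion-resp
    (λ x → let scaled = dot-map-⊗ (real (- r)) b (hom x) in mk⇔
      (λ p → x⊑-r⊗y⇒r⊗x⊑y r (subst (embed (coordinate i x) ⊑_) scaled p))
      (λ p → subst (embed (coordinate i x) ⊑_) (sym scaled) (r⊗x⊑y⇒x⊑-r⊗y r p)))
    (ZoneUnion-⊨ (i , map (real (- r) ⊗ᴳ_) b))

  -- A maximum on the left is bounded exactly when each of its terms is, which gives an intersection
  -- over the coordinates; the maximum on the right gives the union in `ZoneUnion-⊨`.
  ZoneUnion-satisfies : ∀ (I : MixedInequality n) → ZoneUnion (λ x → Satisfies x I)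
  ZoneUnion-satisfies I = ZoneUnion-resp
    (λ x → mk⇔
      (λ p → Equivalence.from (satisfies⇔dot⊑dot I x) (dot-lub (map embed (lhs I)) (hom x) λ i →
        subst (_⊑ dot (rhs I) (hom x)) (sym (term≡ x i)) (p i)))
      (λ p i → ⊑-trans
        (subst (_⊑ dot (map embed (lhs I)) (hom x)) (term≡ x i) (term⊑dot (map embed (lhs I)) (hom x) i))
        (Equivalence.to (satisfies⇔dot⊑dot I x) p)))
    (ZoneUnion-∀ λ i → ZoneUnion-scaled (lookup (lhs I) i) i (rhs I))
    where
    term≡ : ∀ x i → lookup (map embed (lhs I)) i ⊗ᴳ lookup (hom x) i ≡
                    embed (lookup (lhs I) i) ⊗ᴳ embed (coordinate i x)
    term≡ x i = cong₂ _⊗ᴳ_ (lookup-map i embed (lhs I)) (lookup-hom x i)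

  mixed⇒convex∧zones : ∀ {ℓ} (P : Pred (Point n) ℓ) →
                       IsMixedPolyhedron P → IsTropicallyConvex P × IsFiniteUnionOfZones P
  mixed⇒convex∧zones P (Is , P⊆Is , Is⊆P) =
    (λ s t x∈P y∈P s⊕t≡0 → Is⊆P (All.zipWith
      (λ {I} (p , q) → satisfies-convex I s t p q s⊕t≡0) (P⊆Is x∈P , P⊆Is y∈P))) ,
    List.map (λ Z x → All (SatisfiesZone x) Z) (zones U) ,
    All.map⁺ (All.universal (λ Z → Z , (λ {_} p → p) , (λ {_} p → p)) (zones U)) ,
    (λ {x} p → Any.map⁺ (Equivalence.to (spec U x) (P⊆Is p))) ,
    (λ {x} q → Is⊆P (Equivalence.from (spec U x) (Any.map⁻ q)))
    where
    U : ZoneUnion (λ x → All (Satisfies x) Is)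
    U = ZoneUnion-All ZoneUnion-satisfies Is

open Tropical

theorem13 : (R : Reals) (n : ℕ) {ℓ : Level} (P : Pred (Vec (Rmax R) n) ℓ) →
    IsMixedPolyhedron R P ⇔ (IsTropicallyConvex R P × IsFiniteUnionOfZones R P)
theorem13 R n P = mk⇔ (mixed⇒convex∧zones P) (convex∧zones⇒mixed P)
  where open MaxPlus R
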